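{- Let $n>8$ and let $M_n$ be the maximum of $av_1(T)$ over all trees $T$ with $n$ vertices. Then $M_n=\frac n2+\delta_n$ with $0<\delta_n<\frac12$. Moreover, $\lim_{n\to\infty}\big(M_n-\frac{n+1}{2}\big)=0$, as witnessed by the trees $R_n$ obtained from the star $S_{n-1}$ by attaching a new vertex to one of its leaves, which satisfy $\frac n2<av_1(R_n)<\frac{n+1}2$ and $av_1(R_n)-\frac{n+1}{2}\to 0$.
   Context: For a graph $G=(V,E)$, a set $S\subseteq V$ is a $1$-nearly independent vertex set if the subgraph induced by $S$ has exactly one edge. $\sigma_1(G)$ is the number of such sets, $S_1(G)$ the sum of their sizes, and $av_1(G)=S_1(G)/\sigma_1(G)$. $S_m$ denotes the star on $m$ vertices. -}

module Defs where

open import Data.Bool using (Bool; true; false; T)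
open import Data.Bool.Properties using (T?)
open import Data.Fin using (Fin; zero; suc)
open import Data.Fin.Properties using (_<?_; _≟_)
open import Data.Fin.Subset using (Subset; inside; outside; ∣_∣)
open import Data.Fin.Subset.Properties using (_∈?_)
open import Data.Integer using (+_)
open import Data.List using (List; []; _∷_; _++_; map; filter; length; allFin; cartesianProduct)
open import Data.List.Relation.Unary.Linked using (Linked)
open import Data.List.Relation.Unary.Unique.Propositional using (Unique)
open import Data.Nat as ℕ using (ℕ; zero; suc)
open import Data.Nat.ListAction using (sum)
open import Data.Product using (_×_; _,_; ∃-syntax)
open import Data.Rational as ℚ using (ℚ; 0ℚ)
open import Data.Vec using ([]; _∷_)
open import Relation.Binary.Construct.Closure.ReflexiveTransitive using (Star)
open import Relation.Binary.PropositionalEquality using (_≡_; refl)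
open import Relation.Nullary using (¬_; Dec; does)
open import Relation.Nullary.Decidable using (_×-dec_)

record Graph (n : ℕ) : Set where
  field
    adj    : Fin n → Fin n → Bool
    sym    : ∀ i j → adj i j ≡ adj j i
    irrefl : ∀ i → adj i i ≡ false

open Graph public

Adj : ∀ {n} → Graph n → Fin n → Fin n → Set
Adj G i j = T (adj G i j)

Connected : ∀ {n} → Graph n → Set
Connected G = ∀ i j → Star (Adj G) i j

-- The cycle v , vs₁ , … , vsₖ , v, with the closing vertex v left out.
IsCycle : ∀ {n} → Graph n → Fin n → List (Fin n) → Set
IsCycle G v vs =
  2 ℕ.≤ length vs × Unique (v ∷ vs) × Linked (Adj G) (v ∷ vs ++ v ∷ [])

Acyclic : ∀ {n} → Graph n → Set
Acyclic G = ∀ v vs → ¬ IsCycle G v vs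

IsTree : ∀ {n} → Graph n → Set
IsTree G = Connected G × Acyclic G

-- Each edge is listed once, with its smaller endpoint first.
edges : ∀ {n} → Graph n → List (Fin n × Fin n)
edges {n} G =
  filter (λ (i , j) → (i <? j) ×-dec T? (adj G i j))
         (cartesianProduct (allFin n) (allFin n))

inducedEdges : ∀ {n} → Graph n → Subset n → List (Fin n × Fin n)
inducedEdges G S = filter (λ (i , j) → (i ∈? S) ×-dec (j ∈? S)) (edges G)

Is1NearlyIndependent : ∀ {n} → Graph n → Subset n → Set
Is1NearlyIndependent G S = length (inducedEdges G S) ≡ 1

is1NearlyIndependent? : ∀ {n} (G : Graph n) (S : Subset n) → Dec (Is1NearlyIndependent G S)
is1NearlyIndependent? G S = length (inducedEdges G S) ℕ.≟ 1

subsets : ∀ n → List (Subset n)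
subsets zero    = [] ∷ []
subsets (suc n) = map (outside ∷_) (subsets n) ++ map (inside ∷_) (subsets n)

1NearlyIndependentSets : ∀ {n} → Graph n → List (Subset n)
1NearlyIndependentSets {n} G = filter (is1NearlyIndependent? G) (subsets n)

σ₁ : ∀ {n} → Graph n → ℕ
σ₁ G = length (1NearlyIndependentSets G)

S₁ : ∀ {n} → Graph n → ℕ
S₁ G = sum (map ∣_∣ (1NearlyIndependentSets G))

-- Quotient of naturals, with the convention a ÷ 0 = 0.
_÷_ : ℕ → ℕ → ℚ
a ÷ zero  = 0ℚ
a ÷ suc b = + a ℚ./ suc b

-- σ₁ G = 0 only when G has no edge, so the convention for ÷ is never used for
-- a tree with at least two vertices.
av₁ : ∀ {n} → Graph n → ℚ
av₁ G = S₁ G ÷ σ₁ G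

IsMaxAv₁ : ℕ → ℚ → Set
IsMaxAv₁ n m =
  (∃[ T ] IsTree {n} T × av₁ T ≡ m) × (∀ (T : Graph n) → IsTree T → av₁ T ℚ.≤ m)

-- The star on m vertices, with centre zero (when m > 0).
star : ∀ m → Graph m
star m = record { adj = a ; sym = s ; irrefl = r }
  where
  a : ∀ {m} → Fin m → Fin m → Bool
  a zero    zero    = false
  a zero    (suc _) = true
  a (suc _) zero    = true
  a (suc _) (suc _) = false

  s : ∀ {m} (i j : Fin m) → a i j ≡ a j i
  s zero    zero    = refl
  s zero    (suc _) = refl
  s (suc _) zero    = refl
  s (suc _) (suc _) = refl

  r : ∀ {m} (i : Fin m) → a i i ≡ false
  r zero    = refl
  r (suc _) = refl

-- Adds a vertex, numbered zero, whose only neighbour is v; the vertices of G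
-- are shifted by suc.
attach : ∀ {n} → Graph n → Fin n → Graph (suc n)
attach {n} G v = record { adj = a ; sym = s ; irrefl = r }
  where
  a : Fin (suc n) → Fin (suc n) → Bool
  a zero    zero    = false
  a zero    (suc j) = does (j ≟ v)
  a (suc i) zero    = does (i ≟ v)
  a (suc i) (suc j) = adj G i j

  s : ∀ i j → a i j ≡ a j i
  s zero    zero    = refl
  s zero    (suc _) = refl
  s (suc _) zero    = refl
  s (suc i) (suc j) = sym G i j

  r : ∀ i → a i i ≡ false
  r zero    = refl
  r (suc i) = irrefl G i

-- The star on n ∸ 1 vertices with a vertex attached to the leaf suc zero (every
-- choice of leaf gives an isomorphic graph).  For n ≤ 2 that star has no leaf;
-- the value there is arbitrary.
R : ∀ n → Graph n
R (suc (suc (suc k))) = attach (star (suc (suc k))) (suc zero)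
R n                   = star n

TendsTo : (ℕ → ℚ) → ℚ → Set
TendsTo a l = ∀ ε → 0ℚ ℚ.< ε → ∃[ N ] (∀ n → N ℕ.≤ n → ℚ.∣ a n ℚ.- l ∣ ℚ.< ε)

{-# OPTIONS --safe #-}
module Submission where

-- The upper bound holds for every connected graph on n > 3 vertices.  Count the
-- pairs S ⊂ S′ of 1-nearly independent sets that differ in one vertex, once by S′
-- and once by S.  A vertex of S′ outside its unique induced edge can always be
-- removed, so S′ occurs at least |S′| − 2 times.  No vertex adjacent to an endpoint
-- of the edge of S can be added, and connectedness provides such a vertex outside
-- the edge, so S occurs at most n − |S| − 1 times; there is an edge with two such
-- vertices, hence strictness.  Summing, 2 S₁ < (n + 1) σ₁.  On R n with n = k + 3 an
-- exact count gives σ₁ = 2ᵏ + 2k + 1 and (n + 1) σ₁ − 2 S₁ = 2k² − k.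

open import Defs hiding (sym; irrefl)
open import Data.Bool using (Bool; true; false; not; T; _∧_; if_then_else_)
open import Data.Bool.Properties using (T?; ∧-zeroʳ)
open import Data.Fin as Fin using (Fin; zero; suc)
open import Data.Fin.Properties as Fin using (_≟_; _<?_; ¬∀⟶∃¬; all?; any?)
open import Data.Fin.Subset using (Subset; inside; outside; ∣_∣; ⁅_⁆; _∪_)
open import Data.Fin.Subset.Properties using (_∈?_; x∈⁅x⁆; x∈⁅y⁆⇒x≡y; x∈p∪q⁺; x∈p∪q⁻)
open import Data.Integer as ℤ using (+[1+_]; -[1+_]; +<+; +≤+)
import Data.Integer.Properties as ℤ
open import Data.List as List
  using (List; []; _∷_; _++_; map; filter; length; allFin; cartesianProduct;
         cartesianProductWith)
open import Data.List.Membership.Propositional using (_∈_; _∉_)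
open import Data.List.Membership.Propositional.Properties
  using (∈-filter⁺; ∈-filter⁻; ∈-cartesianProduct⁺; ∈-cartesianProductWith⁺; ∈-lookup;
         ∈-allFin; ∈-++⁺ˡ; ∈-++⁺ʳ; ∈-map⁺)
import Data.List.Membership.Setoid.Properties as Membership
open import Data.List.Properties using (map-cong; map-tabulate; filter-≐; map-∘; map-++)
open import Data.List.Relation.Unary.All as All using ([]; _∷_)
open import Data.List.Relation.Unary.All.Properties using (all-filter)
open import Data.List.Relation.Unary.AllPairs using ([]; _∷_)
open import Data.List.Relation.Unary.Any as Any using (here; there)
open import Data.List.Relation.Unary.Linked as Linked using (Linked; linked?; []; [-]; _∷_)
open import Data.List.Relation.Unary.Unique.DecSetoid using (unique?)
open import Data.List.Relation.Unary.Unique.Propositional using (Unique)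
import Data.List.Relation.Unary.Unique.Propositional.Properties as Unique
open import Data.Nat using (ℕ; zero; suc; _+_; _*_; _^_; _≤_; _<_; z≤n; s≤s; s≤s⁻¹)
open import Data.Nat.ListAction using (sum)
open import Data.Nat.ListAction.Properties using (sum-++)
open import Data.Nat.Properties as ℕ
  using (+-mono-≤; +-mono-<-≤; +-mono-≤-<; ≤-refl; ≤-reflexive; ≤-trans; module ≤-Reasoning)
open import Data.Nat.Tactic.RingSolver using (solve-∀)
open import Data.Product using (_×_; _,_; Σ-syntax; ∃-syntax; proj₁)
open import Data.Rational as ℚ using (ℚ; mkℚ; 0ℚ; ½)
open import Data.Rational.Properties as ℚ using (≤-decTotalOrder)
open import Data.Rational.Unnormalised as ℚᵘ using (mkℚᵘ; *≡*; *≤*; *<*)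
import Data.Rational.Unnormalised.Properties as ℚᵘ
open import Data.Sum as Sum using (_⊎_; inj₁; inj₂)
open import Data.Vec as Vec using ([]; _∷_; lookup; updateAt)
open import Data.Vec.Properties
  using ([]=⇒lookup; lookup⇒[]=; lookup∘tabulate; lookup∘updateAt; lookup∘updateAt′)
open import Function using (_∘_)
open import Relation.Binary.Bundles using (DecTotalOrder)
open import Relation.Binary.Construct.Closure.ReflexiveTransitive as Star
  using (Star; ε; _◅_; _◅◅_)
open import Relation.Binary.Definitions using (tri<; tri≈; tri>)
open import Relation.Binary.PropositionalEquality
  using (_≡_; _≢_; refl; sym; trans; cong; cong₂; subst; subst₂; setoid; module ≡-Reasoning)
open import Relation.Nullary using (¬_; Dec; yes; no; does; contradiction)
open import Relation.Nullary.Decidable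
  using (dec-true; dec-false; toWitness; map′; ¬?; _×-dec_; _⊎-dec_)
open import Relation.Unary using (Decidable)
open import Algebra.Properties.AbelianGroup ℚ.+-0-abelianGroup using (⁻¹-anti-homo‿-; xyx⁻¹≈y)
open import Data.List.Extrema (DecTotalOrder.totalOrder ≤-decTotalOrder)
  using (argmax; argmax-all; f[xs]≤f[argmax])

-- The threshold `8 < n` comes from `R n`: with n = k + 3, the inequality n / 2 < av₁ (R n) amounts
-- to 2k² - 3k ≤ 2ᵏ, which fails at k = 5 and holds from k = 6 on. The bound n > 3 comes from
-- strictness: on the path with three vertices the average is exactly (n + 1) / 2, and a fourth
-- vertex is what provides an edge with two neighbours outside it. That the maximum is attained
-- needs an argument of its own. Since `adj` is a function, a list of graphs can be exhaustive only
-- up to pointwise equality of adjacency. Hence `IsTree` and `av₁` are shown to respect that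
-- relation, being a tree is shown decidable, and the maximum is an argmax over a finite list of
-- trees. Both limits are then instances of one squeeze between `av₁ (R n)` and (n + 1) / 2.

private variable
  A B : Set
  n : ℕ

-- Sums over lists and over subsets

⟦_⟧ : Bool → ℕ
⟦ false ⟧ = 0
⟦ true  ⟧ = 1

⟦⟧≤1 : ∀ b → ⟦ b ⟧ ≤ 1
⟦⟧≤1 false = z≤n
⟦⟧≤1 true  = s≤s z≤n

∑ : List A → (A → ℕ) → ℕ
∑ xs f = sum (map f xs)

syntax ∑ xs (λ x → e) = ∑[ x ∈ xs ] e

∑-cong : ∀ (xs : List A) {f g : A → ℕ} → (∀ x → f x ≡ g x) → ∑ xs f ≡ ∑ xs g
∑-cong xs f≗g = cong sum (map-cong f≗g xs)

∑-mono : ∀ (xs : List A) {f g : A → ℕ} → (∀ x → f x ≤ g x) → ∑ xs f ≤ ∑ xs g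
∑-mono []       f≤g = z≤n
∑-mono (x ∷ xs) f≤g = +-mono-≤ (f≤g x) (∑-mono xs f≤g)

∑-mono-< : ∀ {xs : List A} {f g : A → ℕ} {x} →
           (∀ x → f x ≤ g x) → x ∈ xs → f x < g x → ∑ xs f < ∑ xs g
∑-mono-< {xs = _ ∷ xs} f≤g (here refl)  f<g = +-mono-<-≤ f<g (∑-mono xs f≤g)
∑-mono-< {xs = x ∷ _}  f≤g (there x∈xs) f<g = +-mono-≤-< (f≤g x) (∑-mono-< f≤g x∈xs f<g)

∑-zero : ∀ (xs : List A) → ∑[ x ∈ xs ] 0 ≡ 0
∑-zero []       = refl
∑-zero (x ∷ xs) = ∑-zero xs

∑-one : ∀ (xs : List A) → ∑[ x ∈ xs ] 1 ≡ length xs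
∑-one []       = refl
∑-one (x ∷ xs) = cong suc (∑-one xs)

∑-+ : ∀ (xs : List A) (f g : A → ℕ) → ∑[ x ∈ xs ] (f x + g x) ≡ ∑ xs f + ∑ xs g
∑-+ []       f g = refl
∑-+ (x ∷ xs) f g = trans (cong (f x + g x +_) (∑-+ xs f g)) (shuffle (f x) (g x) _ _)
  where
  shuffle : ∀ a b c d → a + b + (c + d) ≡ a + c + (b + d)
  shuffle = solve-∀

∑-*ˡ : ∀ (xs : List A) c (f : A → ℕ) → ∑[ x ∈ xs ] (c * f x) ≡ c * ∑ xs f
∑-*ˡ []       c f = sym (ℕ.*-zeroʳ c)
∑-*ˡ (x ∷ xs) c f = trans (cong (c * f x +_) (∑-*ˡ xs c f)) (sym (ℕ.*-distribˡ-+ c (f x) _))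

∑-*ʳ : ∀ (xs : List A) c (f : A → ℕ) → ∑[ x ∈ xs ] (f x * c) ≡ ∑ xs f * c
∑-*ʳ xs c f = trans (∑-cong xs (λ x → ℕ.*-comm (f x) c)) (trans (∑-*ˡ xs c f) (ℕ.*-comm c _))

∑-swap : ∀ (xs : List A) (ys : List B) (f : A → B → ℕ) →
         ∑[ x ∈ xs ] ∑[ y ∈ ys ] f x y ≡ ∑[ y ∈ ys ] ∑[ x ∈ xs ] f x y
∑-swap []       ys f = sym (∑-zero ys)
∑-swap (x ∷ xs) ys f =
  trans (cong (∑ ys (f x) +_) (∑-swap xs ys f)) (sym (∑-+ ys (f x) _))

∑-++ : ∀ (xs ys : List A) f → ∑ (xs ++ ys) f ≡ ∑ xs f + ∑ ys f
∑-++ xs ys f = trans (cong sum (map-++ f xs ys)) (sum-++ (map f xs) (map f ys))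

∑-map : ∀ (h : A → B) xs f → ∑ (map h xs) f ≡ ∑ xs (f ∘ h)
∑-map h xs f = cong sum (sym (map-∘ xs))

∑-filter : ∀ {P : A → Set} (P? : Decidable P) xs f →
           ∑ (filter P? xs) f ≡ ∑[ x ∈ xs ] (⟦ does (P? x) ⟧ * f x)
∑-filter P? []       f = refl
∑-filter P? (x ∷ xs) f with does (P? x)
... | false = ∑-filter P? xs f
... | true  = cong₂ _+_ (sym (ℕ.+-identityʳ (f x))) (∑-filter P? xs f)

length-filter≡∑ : ∀ {P : A → Set} (P? : Decidable P) xs →
                  length (filter P? xs) ≡ ∑[ x ∈ xs ] ⟦ does (P? x) ⟧
length-filter≡∑ P? xs = begin
  length (filter P? xs)              ≡⟨ ∑-one (filter P? xs) ⟨
  ∑[ x ∈ filter P? xs ] 1            ≡⟨ ∑-filter P? xs _ ⟩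
  ∑[ x ∈ xs ] (⟦ does (P? x) ⟧ * 1)  ≡⟨ ∑-cong xs (λ x → ℕ.*-identityʳ _) ⟩
  ∑[ x ∈ xs ] ⟦ does (P? x) ⟧        ∎
  where open ≡-Reasoning

∑-cartesianProduct : ∀ (xs : List A) (ys : List B) f →
                     ∑ (cartesianProduct xs ys) f ≡ ∑[ x ∈ xs ] ∑[ y ∈ ys ] f (x , y)
∑-cartesianProduct []       ys f = refl
∑-cartesianProduct (x ∷ xs) ys f =
  trans (∑-++ (map (x ,_) ys) _ f)
        (cong₂ _+_ (∑-map (x ,_) ys f) (∑-cartesianProduct xs ys f))

∑-allFin-suc : ∀ n (f : Fin (suc n) → ℕ) →
               ∑ (allFin (suc n)) f ≡ f zero + ∑[ i ∈ allFin n ] f (suc i)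
∑-allFin-suc n f =
  cong (f zero +_) (trans (cong (λ is → ∑ is f) (sym (map-tabulate (λ i → i) suc)))
                          (∑-map suc (allFin n) f))

∑-allFin-one : ∀ n → ∑[ i ∈ allFin n ] 1 ≡ n
∑-allFin-one zero    = refl
∑-allFin-one (suc n) = trans (∑-allFin-suc n (λ _ → 1)) (cong suc (∑-allFin-one n))

∑-allFin-δ : ∀ (i : Fin n) → ∑[ j ∈ allFin n ] ⟦ does (i ≟ j) ⟧ ≡ 1
∑-allFin-δ {suc n} zero    =
  trans (∑-allFin-suc n (λ j → ⟦ does (zero ≟ j) ⟧)) (cong suc (∑-zero (allFin n)))
∑-allFin-δ {suc n} (suc i) =
  trans (∑-allFin-suc n (λ j → ⟦ does (suc i ≟ j) ⟧)) (∑-allFin-δ i)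

∑-subsets-suc : ∀ n (f : Subset (suc n) → ℕ) →
  ∑ (subsets (suc n)) f ≡ ∑[ S ∈ subsets n ] f (outside ∷ S) + ∑[ S ∈ subsets n ] f (inside ∷ S)
∑-subsets-suc n f =
  trans (∑-++ (map (outside ∷_) (subsets n)) _ f)
        (cong₂ _+_ (∑-map (outside ∷_) (subsets n) f) (∑-map (inside ∷_) (subsets n) f))

∈-subsets : ∀ (S : Subset n) → S ∈ subsets n
∈-subsets []            = here refl
∈-subsets {suc n} (outside ∷ S) = ∈-++⁺ˡ (∈-map⁺ (outside ∷_) (∈-subsets S))
∈-subsets {suc n} (inside  ∷ S) =
  ∈-++⁺ʳ (map (outside ∷_) (subsets n)) (∈-map⁺ (inside ∷_) (∈-subsets S))

∣∣≡∑ : ∀ (S : Subset n) → ∣ S ∣ ≡ ∑[ i ∈ allFin n ] ⟦ lookup S i ⟧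
∣∣≡∑ []                    = refl
∣∣≡∑ {suc n} (outside ∷ S) =
  trans (∣∣≡∑ S) (sym (∑-allFin-suc n (λ i → ⟦ lookup (outside ∷ S) i ⟧)))
∣∣≡∑ {suc n} (inside  ∷ S) =
  trans (cong suc (∣∣≡∑ S)) (sym (∑-allFin-suc n (λ i → ⟦ lookup (inside ∷ S) i ⟧)))

toggle : Fin n → Subset n → Subset n
toggle i S = updateAt S i not

-- Toggling `i` is an involution that exchanges the sets containing `i` with those avoiding it. `h`
-- receives both the set and its toggle, so that the induction can prefix the same first bit to
-- both; at `i = zero` the two halves of `subsets` change places.
∑-toggle : ∀ (i : Fin n) (h : Subset n → Subset n → ℕ) →
  ∑[ S ∈ subsets n ] (⟦ lookup S i ⟧ * h S (toggle i S)) ≡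
  ∑[ S ∈ subsets n ] (⟦ not (lookup S i) ⟧ * h (toggle i S) S)
∑-toggle {suc n} zero h =
  trans (∑-subsets-suc n _) (trans (ℕ.+-comm (∑[ S ∈ subsets n ] 0) _) (sym (∑-subsets-suc n _)))
∑-toggle {suc n} (suc i) h =
  trans (∑-subsets-suc n _)
    (trans (cong₂ _+_ (∑-toggle i (λ S S′ → h (outside ∷ S) (outside ∷ S′)))
                      (∑-toggle i (λ S S′ → h (inside ∷ S) (inside ∷ S′))))
           (sym (∑-subsets-suc n _)))

lookup-toggle : ∀ (S : Subset n) w {x} → w ≢ x → lookup (toggle w S) x ≡ lookup S x
lookup-toggle S w w≢x = lookup∘updateAt′ _ w (w≢x ∘ sym) S

-- Toggling a vertex of a 1-nearly independent set

length≡1⇒≡ : ∀ {xs : List A} {x y} → length xs ≡ 1 → x ∈ xs → y ∈ xs → x ≡ y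
length≡1⇒≡ {xs = _ ∷ []} _ (here refl) (here refl) = refl

length≡1⇒∃ : ∀ {xs : List A} → length xs ≡ 1 → ∃[ x ] x ∈ xs
length≡1⇒∃ {xs = x ∷ []} _ = x , here refl

unique-constant⇒length≡1 : ∀ {xs : List A} {x} → Unique xs → x ∈ xs → (∀ {y} → y ∈ xs → x ≡ y) →
                           length xs ≡ 1
unique-constant⇒length≡1 {xs = _ ∷ []}    _                   _ _     = refl
unique-constant⇒length≡1 {xs = _ ∷ _ ∷ _} ((y≢z ∷ _) ∷ _) _ const =
  contradiction (trans (sym (const (here refl))) (const (there (here refl)))) y≢z

module _ (G : Graph n) where

  -- An edge in either orientation, whereas `inducedEdges` lists each edge only with its smaller
  -- endpoint first; `Same` identifies the two orientations.
  InducedEdge : Subset n → Fin n → Fin n → Set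
  InducedEdge S i j = Adj G i j × lookup S i ≡ true × lookup S j ≡ true

  Adj-sym : ∀ {i j} → Adj G i j → Adj G j i
  Adj-sym {i} {j} = subst T (Graph.sym G i j)

  Adj-irrefl : ∀ {i} → ¬ Adj G i i
  Adj-irrefl {i} a = subst T (Graph.irrefl G i) a

  Adj⇒≢ : ∀ {i j} → Adj G i j → i ≢ j
  Adj⇒≢ a refl = Adj-irrefl a

  ∈-inducedEdges⁻ : ∀ {S i j} → (i , j) ∈ inducedEdges G S → InducedEdge S i j
  ∈-inducedEdges⁻ {S} e∈ =
    let e∈edges , i∈S , j∈S = ∈-filter⁻ (λ (i , j) → (i ∈? S) ×-dec (j ∈? S)) {xs = edges G} e∈
        _ , _ , a = ∈-filter⁻ (λ (i , j) → (i <? j) ×-dec T? (adj G i j))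
                              {xs = cartesianProduct (allFin n) (allFin n)} e∈edges
    in a , []=⇒lookup i∈S , []=⇒lookup j∈S

  ∈-inducedEdges⁺ : ∀ {S i j} → InducedEdge S i j →
                    (i , j) ∈ inducedEdges G S ⊎ (j , i) ∈ inducedEdges G S
  ∈-inducedEdges⁺ {S} {i} {j} (a , i∈S , j∈S) with Fin.<-cmp i j
  ... | tri≈ _ i≡j _ = contradiction i≡j (Adj⇒≢ a)
  ... | tri< i<j _ _ = inj₁ (∈-filter⁺ _ (∈-filter⁺ _ (∈-cartesianProduct⁺ (∈-allFin i) (∈-allFin j))
                              (i<j , a)) (lookup⇒[]= i S i∈S , lookup⇒[]= j S j∈S))
  ... | tri> _ _ j<i = inj₂ (∈-filter⁺ _ (∈-filter⁺ _ (∈-cartesianProduct⁺ (∈-allFin j) (∈-allFin i))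
                              (j<i , Adj-sym a)) (lookup⇒[]= j S j∈S , lookup⇒[]= i S i∈S))

  inducedEdges-unique : ∀ S → Unique (inducedEdges G S)
  inducedEdges-unique S = Unique.filter⁺ _ (Unique.filter⁺ _
    (Unique.cartesianProduct⁺ (Unique.allFin⁺ n) (Unique.allFin⁺ n)))

  Same : (i j i′ j′ : Fin n) → Set
  Same i j i′ j′ = (i ≡ i′ × j ≡ j′) ⊎ (i ≡ j′ × j ≡ i′)

  inducedEdges-ordered : ∀ {S i j} → (i , j) ∈ inducedEdges G S → i Fin.< j
  inducedEdges-ordered {S} e∈ =
    let e∈edges , _ = ∈-filter⁻ (λ (i , j) → (i ∈? S) ×-dec (j ∈? S)) {xs = edges G} e∈
        _ , i<j , _ = ∈-filter⁻ (λ (i , j) → (i <? j) ×-dec T? (adj G i j))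
                                {xs = cartesianProduct (allFin n) (allFin n)} e∈edges
    in i<j

  inducedEdge-unique : ∀ {S i j i′ j′} → Is1NearlyIndependent G S →
                       InducedEdge S i j → InducedEdge S i′ j′ → Same i j i′ j′
  inducedEdge-unique one e e′ with ∈-inducedEdges⁺ e | ∈-inducedEdges⁺ e′
  ... | inj₁ p | inj₁ p′ with refl ← length≡1⇒≡ one p p′ = inj₁ (refl , refl)
  ... | inj₁ p | inj₂ p′ with refl ← length≡1⇒≡ one p p′ = inj₂ (refl , refl)
  ... | inj₂ p | inj₁ p′ with refl ← length≡1⇒≡ one p p′ = inj₂ (refl , refl)
  ... | inj₂ p | inj₂ p′ with refl ← length≡1⇒≡ one p p′ = inj₁ (refl , refl)

  inducedEdge-exists : ∀ {S} → Is1NearlyIndependent G S → ∃[ i ] ∃[ j ] InducedEdge S i j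
  inducedEdge-exists one =
    let (i , j) , e∈ = length≡1⇒∃ {xs = inducedEdges G _} one in i , j , ∈-inducedEdges⁻ e∈

  Same-ordered : ∀ {S i j i′ j′} → (i , j) ∈ inducedEdges G S → (i′ , j′) ∈ inducedEdges G S →
                 Same i j i′ j′ → (i , j) ≡ (i′ , j′)
  Same-ordered p q (inj₁ (refl , refl)) = refl
  Same-ordered {S} p q (inj₂ (refl , refl)) =
    contradiction (inducedEdges-ordered {S} q) (Fin.<-asym (inducedEdges-ordered {S} p))

  Same-flip : ∀ {i j i′ j′} → Same i j i′ j′ → Same j i i′ j′
  Same-flip (inj₁ (p , q)) = inj₂ (q , p)
  Same-flip (inj₂ (p , q)) = inj₁ (q , p)

  -- The list of induced edges has no repetitions, and its ordered pairs cannot be reversals of one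
  -- another, so uniqueness up to orientation forces length one. From here on, edges need not be
  -- counted.
  uniqueInducedEdge⇒1NearlyIndependent : ∀ {S i j} → InducedEdge S i j →
    (∀ {i′ j′} → InducedEdge S i′ j′ → Same i j i′ j′) → Is1NearlyIndependent G S
  uniqueInducedEdge⇒1NearlyIndependent {S} e unique with ∈-inducedEdges⁺ e
  ... | inj₁ p = unique-constant⇒length≡1 (inducedEdges-unique S) p λ q →
    Same-ordered p q (unique (∈-inducedEdges⁻ q))
  ... | inj₂ p = unique-constant⇒length≡1 (inducedEdges-unique S) p λ q →
    Same-ordered p q (Same-flip (unique (∈-inducedEdges⁻ q)))

  -- With an indicator, `σ₁` and `S₁` become sums over all subsets, a range closed under `toggle`;
  -- the family of 1-nearly independent sets is in general not closed under it.
  χ : Subset n → ℕ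
  χ S = ⟦ does (is1NearlyIndependent? G S) ⟧

  χ≡1 : ∀ {S} → Is1NearlyIndependent G S → χ S ≡ 1
  χ≡1 {S} one = cong ⟦_⟧ (dec-true (is1NearlyIndependent? G S) one)

  χ≡0 : ∀ {S} → ¬ Is1NearlyIndependent G S → χ S ≡ 0
  χ≡0 {S} ¬one = cong ⟦_⟧ (dec-false (is1NearlyIndependent? G S) ¬one)

  σ₁≡∑χ : σ₁ G ≡ ∑ (subsets n) χ
  σ₁≡∑χ = length-filter≡∑ (is1NearlyIndependent? G) (subsets n)

  S₁≡∑χ : S₁ G ≡ ∑[ S ∈ subsets n ] (χ S * ∣ S ∣)
  S₁≡∑χ = ∑-filter (is1NearlyIndependent? G) (subsets n) ∣_∣

  removable addable : Subset n → ℕ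
  removable S = ∑[ w ∈ allFin n ] (⟦ lookup S w ⟧ * χ (toggle w S))
  addable   S = ∑[ w ∈ allFin n ] (⟦ not (lookup S w) ⟧ * χ (toggle w S))

  -- Both sides count the pairs S ⊂ S′ of 1-nearly independent sets that differ
  -- in one vertex, the left one by S′ and the right one by S.
  ∑-removable≡∑-addable :
    ∑[ S ∈ subsets n ] (χ S * removable S) ≡ ∑[ S ∈ subsets n ] (χ S * addable S)
  ∑-removable≡∑-addable = begin
    ∑[ S ∈ subsets n ] (χ S * removable S)
      ≡⟨ expand (λ S w → ⟦ lookup S w ⟧) ⟩
    ∑[ w ∈ allFin n ] ∑[ S ∈ subsets n ] (⟦ lookup S w ⟧ * (χ S * χ (toggle w S)))
      ≡⟨ ∑-cong (allFin n) (λ w → ∑-toggle w (λ S S′ → χ S * χ S′)) ⟩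
    ∑[ w ∈ allFin n ] ∑[ S ∈ subsets n ] (⟦ not (lookup S w) ⟧ * (χ (toggle w S) * χ S))
      ≡⟨ ∑-cong (allFin n) (λ w → ∑-cong (subsets n) λ S →
           cong (⟦ not (lookup S w) ⟧ *_) (ℕ.*-comm (χ (toggle w S)) (χ S))) ⟩
    ∑[ w ∈ allFin n ] ∑[ S ∈ subsets n ] (⟦ not (lookup S w) ⟧ * (χ S * χ (toggle w S)))
      ≡⟨ expand (λ S w → ⟦ not (lookup S w) ⟧) ⟨
    ∑[ S ∈ subsets n ] (χ S * addable S)
      ∎
    where
    open ≡-Reasoning
    swap : ∀ a b c → a * (b * c) ≡ b * (a * c)
    swap = solve-∀
    expand : ∀ (f : Subset n → Fin n → ℕ) →
      ∑[ S ∈ subsets n ] (χ S * ∑[ w ∈ allFin n ] (f S w * χ (toggle w S))) ≡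
      ∑[ w ∈ allFin n ] ∑[ S ∈ subsets n ] (f S w * (χ S * χ (toggle w S)))
    expand f = trans
      (∑-cong (subsets n) λ S → trans (sym (∑-*ˡ (allFin n) (χ S) _))
        (∑-cong (allFin n) λ w → swap (χ S) (f S w) _))
      (∑-swap (subsets n) (allFin n) _)

  -- A smaller set induces no new edge, and the edge `i j` survives because `w` is neither of its
  -- endpoints.
  removal : ∀ {S i j w} → Is1NearlyIndependent G S → InducedEdge S i j →
            lookup S w ≡ true → i ≢ w → j ≢ w → Is1NearlyIndependent G (toggle w S)
  removal {S} {i} {j} {w} one e@(a , i∈S , j∈S) w∈S i≢w j≢w =
    uniqueInducedEdge⇒1NearlyIndependent
      (a , trans (lookup-toggle S w (i≢w ∘ sym)) i∈S , trans (lookup-toggle S w (j≢w ∘ sym)) j∈S)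
      λ (a′ , x∈ , y∈) → inducedEdge-unique one e (a′ , shrink x∈ , shrink y∈)
    where
    shrink : ∀ {x} → lookup (toggle w S) x ≡ true → lookup S x ≡ true
    shrink {x} x∈ with w ≟ x
    ... | no w≢x   = trans (sym (lookup-toggle S w w≢x)) x∈
    ... | yes refl = w∈S

  ∣∣≤2+removable : ∀ {S} → Is1NearlyIndependent G S → ∣ S ∣ ≤ 2 + removable S
  ∣∣≤2+removable {S} one with inducedEdge-exists {S} one
  ... | i , j , e = begin
    ∣ S ∣
      ≡⟨ ∣∣≡∑ S ⟩
    ∑[ w ∈ allFin n ] ⟦ lookup S w ⟧
      ≤⟨ ∑-mono (allFin n) pointwise ⟩
    ∑[ w ∈ allFin n ] (⟦ does (i ≟ w) ⟧ + (⟦ does (j ≟ w) ⟧ + ⟦ lookup S w ⟧ * χ (toggle w S)))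
      ≡⟨ trans (∑-+ (allFin n) _ _) (cong₂ _+_ (∑-allFin-δ i)
          (trans (∑-+ (allFin n) _ _) (cong (_+ removable S) (∑-allFin-δ j)))) ⟩
    2 + removable S
      ∎
    where
    open ≤-Reasoning
    pointwise : ∀ w → ⟦ lookup S w ⟧ ≤
      ⟦ does (i ≟ w) ⟧ + (⟦ does (j ≟ w) ⟧ + ⟦ lookup S w ⟧ * χ (toggle w S))
    pointwise w with i ≟ w | j ≟ w | lookup S w in w∈S
    ... | _       | _       | false = z≤n
    ... | yes _   | _       | true  = s≤s z≤n
    ... | no _    | yes _   | true  = s≤s z≤n
    ... | no i≢w  | no j≢w  | true  =
      ≤-reflexive (sym (trans (ℕ.+-identityʳ _) (χ≡1 (removal one e w∈S i≢w j≢w))))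

  -- Neighbours of the induced edge, which cannot be added

  Blocks : Fin n → Fin n → Fin n → Set
  Blocks i j z = z ≢ i × z ≢ j × (Adj G i z ⊎ Adj G j z)

  -- The edge from `z` to an endpoint would be a second induced edge: as `z` differs from both
  -- endpoints, it is not `i j` in either orientation.
  blocked : ∀ {S i j z} → InducedEdge S i j → Blocks i j z → lookup S z ≡ true →
            ¬ Is1NearlyIndependent G S
  blocked (a , i∈S , j∈S) (z≢i , z≢j , inj₁ i~z) z∈S one
    with inducedEdge-unique one (a , i∈S , j∈S) (i~z , i∈S , z∈S)
  ... | inj₁ (_ , j≡z) = z≢j (sym j≡z)
  ... | inj₂ (i≡z , _) = z≢i (sym i≡z)
  blocked (a , i∈S , j∈S) (z≢i , z≢j , inj₂ j~z) z∈S one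
    with inducedEdge-unique one (a , i∈S , j∈S) (j~z , j∈S , z∈S)
  ... | inj₁ (_ , j≡z) = z≢j (sym j≡z)
  ... | inj₂ (i≡z , _) = z≢i (sym i≡z)

  -- Blocking, belonging to `S` and being addable exclude one another, so each vertex is counted at
  -- most once. The weight `b` is left general to serve for one blocking vertex and for two.
  block-count : ∀ {S i j} (b : Fin n → ℕ) → Is1NearlyIndependent G S → InducedEdge S i j →
                (∀ w → b w ≡ 0 ⊎ (b w ≡ 1 × Blocks i j w)) →
                ∑ (allFin n) b + (∣ S ∣ + addable S) ≤ n
  block-count {S} {i} {j} b one e@(a , i∈S , j∈S) b-spec = begin
    ∑ (allFin n) b + (∣ S ∣ + addable S)
      ≡⟨ cong (λ s → ∑ (allFin n) b + (s + addable S)) (∣∣≡∑ S) ⟩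
    ∑ (allFin n) b + (∑[ w ∈ allFin n ] ⟦ lookup S w ⟧ + addable S)
      ≡⟨ trans (∑-+ (allFin n) _ _) (cong (∑ (allFin n) b +_) (∑-+ (allFin n) _ _)) ⟨
    ∑[ w ∈ allFin n ] (b w + (⟦ lookup S w ⟧ + ⟦ not (lookup S w) ⟧ * χ (toggle w S)))
      ≤⟨ ∑-mono (allFin n) (λ w → pointwise w (b-spec w)) ⟩
    ∑[ w ∈ allFin n ] 1
      ≡⟨ ∑-allFin-one n ⟩
    n ∎
    where
    open ≤-Reasoning
    pointwise : ∀ w → b w ≡ 0 ⊎ (b w ≡ 1 × Blocks i j w) →
      b w + (⟦ lookup S w ⟧ + ⟦ not (lookup S w) ⟧ * χ (toggle w S)) ≤ 1
    pointwise w (inj₁ bw≡0) rewrite bw≡0 with lookup S w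
    ... | true  = ≤-refl
    ... | false = ≤-trans (≤-reflexive (ℕ.+-identityʳ _)) (⟦⟧≤1 (does (is1NearlyIndependent? G (toggle w S))))
    pointwise w (inj₂ (bw≡1 , w-blocks@(w≢i , w≢j , _))) rewrite bw≡1 with lookup S w in w∈S
    ... | true  = contradiction one (blocked e w-blocks w∈S)
    ... | false = s≤s (≤-reflexive (trans (ℕ.+-identityʳ _) (χ≡0 (blocked
      (a , trans (lookup-toggle S w w≢i) i∈S , trans (lookup-toggle S w w≢j) j∈S) w-blocks
      (trans (lookup∘updateAt w S) (cong not w∈S))))))

  1+∣∣+addable≤n : ∀ {S i j z} → Is1NearlyIndependent G S → InducedEdge S i j → Blocks i j z →
                   1 + (∣ S ∣ + addable S) ≤ n
  1+∣∣+addable≤n {S} {z = z} one e z-blocks =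
    subst (λ k → k + (∣ S ∣ + addable S) ≤ n) (∑-allFin-δ z) (block-count _ one e spec)
    where
    spec : ∀ w → ⟦ does (z ≟ w) ⟧ ≡ 0 ⊎ (⟦ does (z ≟ w) ⟧ ≡ 1 × Blocks _ _ w)
    spec w with z ≟ w
    ... | yes refl = inj₂ (refl , z-blocks)
    ... | no _     = inj₁ refl

  2+∣∣+addable≤n : ∀ {S i j z z′} → Is1NearlyIndependent G S → InducedEdge S i j →
                   z ≢ z′ → Blocks i j z → Blocks i j z′ → 2 + (∣ S ∣ + addable S) ≤ n
  2+∣∣+addable≤n {S} {z = z} {z′} one e z≢z′ z-blocks z′-blocks =
    subst (λ k → k + (∣ S ∣ + addable S) ≤ n)
          (trans (∑-+ (allFin n) _ _) (cong₂ _+_ (∑-allFin-δ z) (∑-allFin-δ z′)))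
          (block-count _ one e spec)
    where
    spec : ∀ w → ⟦ does (z ≟ w) ⟧ + ⟦ does (z′ ≟ w) ⟧ ≡ 0
               ⊎ (⟦ does (z ≟ w) ⟧ + ⟦ does (z′ ≟ w) ⟧ ≡ 1 × Blocks _ _ w)
    spec w with z ≟ w | z′ ≟ w
    ... | yes refl | yes refl = contradiction refl z≢z′
    ... | yes refl | no _     = inj₂ (refl , z-blocks)
    ... | no _     | yes refl = inj₂ (refl , z′-blocks)
    ... | no _     | no _     = inj₁ refl

  -- The edge sought is the step by which the walk first leaves `P`.
  crossing-edge : ∀ {P : Fin n → Set} → Decidable P → ∀ {i j} → Star (Adj G) i j → P i → ¬ P j →
             ∃[ k ] ∃[ l ] Adj G k l × P k × ¬ P l
  crossing-edge P? ε Pi ¬Pj = contradiction Pi ¬Pj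
  crossing-edge P? (_◅_ {j = k} i~k k⋯j) Pi ¬Pj with P? k
  ... | yes Pk = crossing-edge P? k⋯j Pk ¬Pj
  ... | no ¬Pk = _ , k , i~k , Pi , ¬Pk

-- The upper bound for connected graphs

-- Pigeonhole: if every vertex occurred in `xs`, its position would inject `Fin n` into
-- `Fin (length xs)`.
fresh : ∀ (xs : List (Fin n)) → length xs < n → ∃[ x ] x ∉ xs
fresh {n} xs ∣xs∣<n = ¬∀⟶∃¬ n (_∈ xs) (λ x → Any.any? (x ≟_) xs) λ x∈xs →
  ℕ.<⇒≱ ∣xs∣<n (Fin.injective⇒≤ {f = λ x → Any.index (x∈xs x)} λ {x} {y} →
    Membership.index-injective (setoid (Fin n)) (x∈xs x) (x∈xs y))

module _ (G : Graph n) (connected : Connected G) where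

  boundary-edge : ∀ x xs → length (x ∷ xs) < n →
                  ∃[ k ] ∃[ l ] Adj G k l × k ∈ x ∷ xs × l ∉ x ∷ xs
  boundary-edge x xs ∣xs∣<n =
    let y , y∉xs = fresh (x ∷ xs) ∣xs∣<n
    in crossing-edge G (λ z → Any.any? (z ≟_) (x ∷ xs)) (connected x y) (here refl) y∉xs

  blocker : 2 < n → ∀ i j → ∃[ z ] Blocks G i j z
  blocker 2<n i j with boundary-edge i (j ∷ []) 2<n
  ... | k , z , i~z , here refl , z∉ =
    z , z∉ ∘ here , z∉ ∘ there ∘ here , inj₁ i~z
  ... | k , z , j~z , there (here refl) , z∉ =
    z , z∉ ∘ here , z∉ ∘ there ∘ here , inj₂ j~z

  DoublyBlocked : Set
  DoublyBlocked =
    ∃[ i ] ∃[ j ] ∃[ z ] ∃[ z′ ] Adj G i j × z ≢ z′ × Blocks G i j z × Blocks G i j z′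

  -- Some edge leaves the path `p m q` towards a new vertex `d`. If it starts at `m` or `p`, the
  -- edge `m p` is blocked by `q` and `d`; if it starts at `q`, the edge `m q` is blocked by `p` and
  -- `d`.
  path⇒doubly-blocked : 3 < n → ∀ {p m q} → p ≢ q → Adj G m p → Adj G m q → DoublyBlocked
  path⇒doubly-blocked 3<n {p} {m} {q} p≢q m~p m~q with boundary-edge m (p ∷ q ∷ []) 3<n
  ... | _ , d , m~d , here refl , d∉ =
    m , p , q , d , m~p , d∉ ∘ there ∘ there ∘ here ∘ sym ,
    (Adj⇒≢ G m~q ∘ sym , p≢q ∘ sym , inj₁ m~q) ,
    (d∉ ∘ here , d∉ ∘ there ∘ here , inj₁ m~d)
  ... | _ , d , p~d , there (here refl) , d∉ =
    m , p , q , d , m~p , d∉ ∘ there ∘ there ∘ here ∘ sym ,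
    (Adj⇒≢ G m~q ∘ sym , p≢q ∘ sym , inj₁ m~q) ,
    (d∉ ∘ here , d∉ ∘ there ∘ here , inj₂ p~d)
  ... | _ , d , q~d , there (there (here refl)) , d∉ =
    m , q , p , d , m~q , d∉ ∘ there ∘ here ∘ sym ,
    (Adj⇒≢ G m~p ∘ sym , p≢q , inj₁ m~p) ,
    (d∉ ∘ here , d∉ ∘ there ∘ there ∘ here , inj₂ q~d)

  doubly-blocked-edge : 3 < n → DoublyBlocked
  doubly-blocked-edge 3<n with fresh {n} [] (ℕ.≤-trans (s≤s z≤n) 3<n)
  ... | a , _ with boundary-edge a [] (ℕ.≤-trans (s≤s (s≤s z≤n)) 3<n)
  ... | _ , b , a~b , here refl , _ with blocker (ℕ.<⇒≤ 3<n) a b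
  ... | c , _   , c≢b , inj₁ a~c = path⇒doubly-blocked 3<n c≢b a~c a~b
  ... | c , c≢a , _   , inj₂ b~c = path⇒doubly-blocked 3<n c≢a b~c (Adj-sym G a~b)

  -- Strictness at a doubly blocked edge takes effect only if some counted set has that edge as its
  -- induced edge; the bare pair of endpoints is such a set.
  pair-nearlyIndependent : ∀ {i j} → Adj G i j → ∃[ S ] Is1NearlyIndependent G S × InducedEdge G S i j
  pair-nearlyIndependent {i} {j} i~j =
    S , uniqueInducedEdge⇒1NearlyIndependent G e only , e
    where
    S : Subset n
    S = ⁅ i ⁆ ∪ ⁅ j ⁆

    e : InducedEdge G S i j
    e = i~j , []=⇒lookup (x∈p∪q⁺ (inj₁ (x∈⁅x⁆ i))) , []=⇒lookup (x∈p∪q⁺ {p = ⁅ i ⁆} (inj₂ (x∈⁅x⁆ j)))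

    member : ∀ {x} → lookup S x ≡ true → x ≡ i ⊎ x ≡ j
    member {x} x∈S = Sum.map (x∈⁅y⁆⇒x≡y i) (x∈⁅y⁆⇒x≡y j) (x∈p∪q⁻ ⁅ i ⁆ ⁅ j ⁆ (lookup⇒[]= x S x∈S))

    only : ∀ {x y} → InducedEdge G S x y → Same G i j x y
    only (x~y , x∈S , y∈S) with member x∈S | member y∈S
    ... | inj₁ refl | inj₁ refl = contradiction x~y (Adj-irrefl G)
    ... | inj₁ refl | inj₂ refl = inj₁ (refl , refl)
    ... | inj₂ refl | inj₁ refl = inj₂ (refl , refl)
    ... | inj₂ refl | inj₂ refl = contradiction x~y (Adj-irrefl G)

  2*S₁<[1+n]*σ₁ : 3 < n → 2 * S₁ G < suc n * σ₁ G
  2*S₁<[1+n]*σ₁ 3<n with doubly-blocked-edge 3<n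
  ... | i , j , z , z′ , i~j , z≢z′ , z-blocks , z′-blocks with pair-nearlyIndependent i~j
  -- `X` counts the pairs by their smaller set. The pointwise estimate replaces it by the count by
  -- larger sets, which is `X` again, so it cancels.
  ... | S⋆ , one⋆ , e⋆ = ℕ.+-cancelʳ-< X _ _ (begin-strict
    2 * S₁ G + X
      ≡⟨ cong (λ s → 2 * s + X) (S₁≡∑χ G) ⟩
    2 * ∑[ S ∈ subsets n ] (χ G S * ∣ S ∣) + X
      ≡⟨ cong (_+ X) (∑-*ˡ (subsets n) 2 _) ⟨
    ∑[ S ∈ subsets n ] (2 * (χ G S * ∣ S ∣)) + X
      ≡⟨ ∑-+ (subsets n) _ _ ⟨
    ∑[ S ∈ subsets n ] (2 * (χ G S * ∣ S ∣) + χ G S * addable G S)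
      <⟨ ∑-mono-< pointwise (∈-subsets S⋆) pointwise-< ⟩
    ∑[ S ∈ subsets n ] (suc n * χ G S + χ G S * removable G S)
      ≡⟨ ∑-+ (subsets n) _ _ ⟩
    ∑[ S ∈ subsets n ] (suc n * χ G S) + ∑[ S ∈ subsets n ] (χ G S * removable G S)
      ≡⟨ cong₂ _+_ (trans (∑-*ˡ (subsets n) (suc n) (χ G)) (cong (suc n *_) (sym (σ₁≡∑χ G))))
                   (∑-removable≡∑-addable G) ⟩
    suc n * σ₁ G + X ∎)
    where
    open ≤-Reasoning
    X : ℕ
    X = ∑[ S ∈ subsets n ] (χ G S * addable G S)

    rearrangeˡ : ∀ k s a → k + (2 * (1 * s) + 1 * a) ≡ s + (k + (s + a))
    rearrangeˡ = solve-∀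

    rearrangeʳ : ∀ r m → 2 + r + m ≡ suc (suc m * 1 + 1 * r)
    rearrangeʳ = solve-∀

    -- `k` is the number of blocking vertices. After cancelling one successor, `k = 1` gives the
    -- weak inequality for `S` and `k = 2` the strict one.
    combine : ∀ k {S} → Is1NearlyIndependent G S → k + (∣ S ∣ + addable G S) ≤ n →
      k + (2 * (χ G S * ∣ S ∣) + χ G S * addable G S) ≤ suc (suc n * χ G S + χ G S * removable G S)
    combine k {S} one ≤n rewrite χ≡1 G one =
      subst₂ _≤_ (sym (rearrangeˡ k ∣ S ∣ _)) (rearrangeʳ _ n)
             (+-mono-≤ (∣∣≤2+removable G one) ≤n)

    pointwise : ∀ S → 2 * (χ G S * ∣ S ∣) + χ G S * addable G S ≤ suc n * χ G S + χ G S * removable G S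
    pointwise S with is1NearlyIndependent? G S
    ... | no ¬one rewrite χ≡0 G ¬one = z≤n
    ... | yes one with inducedEdge-exists G {S} one
    ... | i , j , e with blocker (ℕ.<⇒≤ 3<n) i j
    ... | _ , blocks = s≤s⁻¹ (combine 1 one (1+∣∣+addable≤n G one e blocks))

    pointwise-< : 2 * (χ G S⋆ * ∣ S⋆ ∣) + χ G S⋆ * addable G S⋆ < suc n * χ G S⋆ + χ G S⋆ * removable G S⋆
    pointwise-< = s≤s⁻¹ (combine 2 one⋆ (2+∣∣+addable≤n G one⋆ e⋆ z≢z′ z-blocks z′-blocks))

-- Trees are decidable and finite in number

-- Walks from i to j whose interior vertices are taken from the given list, as
-- in Warshall's algorithm.
module Reachability {A : Set} (_~_ : A → A → Set) where

  Via : List A → A → A → Set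
  Via []       i j = i ~ j
  Via (m ∷ ms) i j = Via ms i j ⊎ (Via ms i m × Via ms m j)

  via? : (∀ i j → Dec (i ~ j)) → ∀ ms i j → Dec (Via ms i j)
  via? _~?_ []       i j = i ~? j
  via? _~?_ (m ∷ ms) i j = via? _~?_ ms i j ⊎-dec (via? _~?_ ms i m ×-dec via? _~?_ ms m j)

  direct : ∀ ms {i j} → i ~ j → Via ms i j
  direct []       i~j = i~j
  direct (m ∷ ms) i~j = inj₁ (direct ms i~j)

  Via⇒Star : ∀ ms {i j} → Via ms i j → Star _~_ i j
  Via⇒Star []       i~j             = i~j ◅ ε
  Via⇒Star (m ∷ ms) (inj₁ v)        = Via⇒Star ms v
  Via⇒Star (m ∷ ms) (inj₂ (v , v′)) = Via⇒Star ms v ◅◅ Via⇒Star ms v′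

  -- Walks are joined by cutting out detours: when both pass through `m`, the part between the two
  -- visits is dropped, so `m` remains a single splitting point.
  concat : ∀ {ms} {i k j} → k ∈ ms → Via ms i k → Via ms k j → Via ms i j
  concat {m ∷ ms} (here refl) u v = inj₂ (into u , from v)
    where
    into : ∀ {i} → Via (m ∷ ms) i m → Via ms i m
    into (inj₁ u)       = u
    into (inj₂ (u , _)) = u
    from : ∀ {j} → Via (m ∷ ms) m j → Via ms m j
    from (inj₁ v)       = v
    from (inj₂ (_ , v)) = v
  concat (there k∈) (inj₁ u)       (inj₁ v)       = inj₁ (concat k∈ u v)
  concat (there k∈) (inj₁ u)       (inj₂ (v , w)) = inj₂ (concat k∈ u v , w)
  concat (there k∈) (inj₂ (u , v)) (inj₁ w)       = inj₂ (u , concat k∈ v w)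
  concat (there k∈) (inj₂ (u , _)) (inj₂ (_ , w)) = inj₂ (u , w)

  Star⇒Via : ∀ {ms} → (∀ k → k ∈ ms) → ∀ {i j} → Star _~_ i j → i ≡ j ⊎ Via ms i j
  Star⇒Via {ms} all∈ ε = inj₁ refl
  Star⇒Via {ms} all∈ (i~k ◅ k⋯j) with Star⇒Via {ms} all∈ k⋯j
  ... | inj₁ refl = inj₂ (direct ms i~k)
  ... | inj₂ v    = inj₂ (concat (all∈ _) (direct ms i~k) v)

star? : ∀ (G : Graph n) i j → Dec (Star (Adj G) i j)
star? {n} G i j = map′ to (Star⇒Via ∈-allFin) (i ≟ j ⊎-dec via? (λ i j → T? (adj G i j)) (allFin n) i j)
  where
  open Reachability (Adj G)
  to : i ≡ j ⊎ Via (allFin n) i j → Star (Adj G) i j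
  to (inj₁ refl) = ε
  to (inj₂ v)    = Via⇒Star (allFin n) v

connected? : ∀ (G : Graph n) → Dec (Connected G)
connected? G = all? λ i → all? λ j → star? G i j

unique-lookup-injective : ∀ {xs : List A} → Unique xs → ∀ {i j} →
                          List.lookup xs i ≡ List.lookup xs j → i ≡ j
unique-lookup-injective (_    ∷ _) {zero}  {zero}  _  = refl
unique-lookup-injective (x≢xs ∷ _) {zero}  {suc j} eq = contradiction eq (All.lookup x≢xs (∈-lookup j))
unique-lookup-injective (x≢xs ∷ _) {suc i} {zero}  eq = contradiction (sym eq) (All.lookup x≢xs (∈-lookup i))
unique-lookup-injective (_    ∷ u) {suc i} {suc j} eq = cong suc (unique-lookup-injective u eq)

unique⇒length≤n : ∀ {xs : List (Fin n)} → Unique xs → length xs ≤ n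
unique⇒length≤n u = Fin.injective⇒≤ (unique-lookup-injective u)

anyListOfLength? : ∀ {P : List (Fin n) → Set} → Decidable P → ∀ k → Dec (∃[ xs ] length xs ≡ k × P xs)
anyListOfLength? P? zero    = map′ (λ P[] → [] , refl , P[]) (λ { ([] , _ , P[]) → P[] }) (P? [])
anyListOfLength? P? (suc k) = map′ (λ (x , xs , eq , Px∷xs) → x ∷ xs , cong suc eq , Px∷xs)
                        (λ { (x ∷ xs , eq , Px∷xs) → x , xs , ℕ.suc-injective eq , Px∷xs })
                        (any? λ x → anyListOfLength? (P? ∘ (x ∷_)) k)

isCycle? : ∀ (G : Graph n) v vs → Dec (IsCycle G v vs)
isCycle? {n} G v vs = (2 ℕ.≤? length vs) ×-dec unique? (Fin.≡-decSetoid n) (v ∷ vs)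
                      ×-dec linked? (λ i j → T? (adj G i j)) (v ∷ vs ++ v ∷ [])

-- The vertices of a cycle are distinct, so `vs` has length at most `n`, and the search over all
-- lists becomes a finite one.
acyclic? : ∀ (G : Graph n) → Dec (Acyclic G)
acyclic? {n} G = all? λ v → map′ (no-short-cycle⇒no-cycle v)
  (λ no-cycle (_ , _ , vs , _ , cycle) → no-cycle vs cycle)
  (¬? (ℕ.anyUpTo? (anyListOfLength? (isCycle? G v)) (suc n)))
  where
  no-short-cycle⇒no-cycle : ∀ v →
    ¬ (∃[ k ] k < suc n × ∃[ vs ] length vs ≡ k × IsCycle G v vs) → ∀ vs → ¬ IsCycle G v vs
  no-short-cycle⇒no-cycle v none vs cycle@(_ , _ ∷ vs-unique , _) =
    none (length vs , s≤s (unique⇒length≤n vs-unique) , vs , refl , cycle)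

isTree? : ∀ (G : Graph n) → Dec (IsTree G)
isTree? G = connected? G ×-dec acyclic? G

-- Enumeration of graphs up to equal adjacency, and a tree attaining the maximum

infix 4 _≐_
_≐_ : Graph n → Graph n → Set
G ≐ H = ∀ i j → adj G i j ≡ adj H i j

Adj-resp-≐ : ∀ {G H : Graph n} → G ≐ H → ∀ {i j} → Adj G i j → Adj H i j
Adj-resp-≐ G≐H {i} {j} = subst T (G≐H i j)

≐-sym : ∀ {G H : Graph n} → G ≐ H → H ≐ G
≐-sym G≐H i j = sym (G≐H i j)

IsTree-resp-≐ : ∀ {G H : Graph n} → G ≐ H → IsTree G → IsTree H
IsTree-resp-≐ {G = G} {H} G≐H (connected , acyclic) =
  (λ i j → Star.map (Adj-resp-≐ {G = G} {H} G≐H) (connected i j)) ,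
  λ v vs (2≤ , unique , linked) →
    acyclic v vs (2≤ , unique , Linked.map (Adj-resp-≐ {G = H} {G} (≐-sym {G = G} {H} G≐H)) linked)

edges-cong : ∀ {G H : Graph n} → G ≐ H → edges G ≡ edges H
edges-cong {n} {G} {H} G≐H = filter-≐ _ _
  ((λ (i<j , a) → i<j , Adj-resp-≐ {G = G} {H} G≐H a) ,
   (λ (i<j , a) → i<j , Adj-resp-≐ {G = H} {G} (≐-sym {G = G} {H} G≐H) a))
  (cartesianProduct (allFin n) (allFin n))

inducedEdges-cong : ∀ {G H : Graph n} → G ≐ H → ∀ S → inducedEdges G S ≡ inducedEdges H S
inducedEdges-cong {G = G} {H} G≐H S = cong (filter _) (edges-cong {G = G} {H} G≐H)

1NearlyIndependentSets-cong : ∀ {G H : Graph n} → G ≐ H →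
                              1NearlyIndependentSets G ≡ 1NearlyIndependentSets H
1NearlyIndependentSets-cong {n} {G} {H} G≐H = filter-≐ _ _
  ((λ {S} one → trans (cong length (sym (inducedEdges-cong {G = G} {H} G≐H S))) one) ,
   (λ {S} one → trans (cong length (inducedEdges-cong {G = G} {H} G≐H S)) one))
  (subsets n)

av₁-cong : ∀ {G H : Graph n} → G ≐ H → av₁ G ≡ av₁ H
av₁-cong {G = G} {H} G≐H =
  cong (λ sets → sum (map ∣_∣ sets) ÷ length sets) (1NearlyIndependentSets-cong {G = G} {H} G≐H)

delete : Graph (suc n) → Graph n
delete G = record
  { adj    = λ i j → adj G (suc i) (suc j)
  ; sym    = λ i j → Graph.sym G (suc i) (suc j)
  ; irrefl = λ i → Graph.irrefl G (suc i)
  }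

extend : Subset n → Graph n → Graph (suc n)
extend {n} N G = record { adj = a ; sym = s ; irrefl = r }
  where
  a : Fin (suc n) → Fin (suc n) → Bool
  a zero    zero    = false
  a zero    (suc j) = lookup N j
  a (suc i) zero    = lookup N i
  a (suc i) (suc j) = adj G i j

  s : ∀ i j → a i j ≡ a j i
  s zero    zero    = refl
  s zero    (suc _) = refl
  s (suc _) zero    = refl
  s (suc i) (suc j) = Graph.sym G i j

  r : ∀ i → a i i ≡ false
  r zero    = refl
  r (suc i) = Graph.irrefl G i

graphs : ∀ n → List (Graph n)
graphs zero    = record { adj = λ () ; sym = λ () ; irrefl = λ () } ∷ []
graphs (suc n) = cartesianProductWith extend (subsets n) (graphs n)

-- `G` is rebuilt from the neighbourhood of vertex zero, stored as a subset, and from the graph left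
-- after deleting that vertex.
graphs-complete : ∀ (G : Graph n) → ∃[ H ] H ∈ graphs n × G ≐ H
graphs-complete {zero}  G = _ , here refl , λ ()
graphs-complete {suc n} G with graphs-complete (delete G)
... | H , H∈ , G≐H = extend N H , ∈-cartesianProductWith⁺ extend (∈-subsets N) H∈ , agree
  where
  N : Subset n
  N = Vec.tabulate (adj G zero ∘ suc)

  agree : G ≐ extend N H
  agree zero    zero    = Graph.irrefl G zero
  agree zero    (suc j) = sym (lookup∘tabulate (adj G zero ∘ suc) j)
  agree (suc i) zero    = trans (Graph.sym G (suc i) zero) (sym (lookup∘tabulate (adj G zero ∘ suc) i))
  agree (suc i) (suc j) = G≐H i j

argmax-maximal : ∀ (f : A → ℚ) x {xs y} → y ∈ xs → f y ℚ.≤ f (argmax f x xs)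
argmax-maximal f x {xs} y∈xs = All.lookup (f[xs]≤f[argmax] {f = f} x xs) y∈xs

trees : ∀ n → List (Graph n)
trees n = filter isTree? (graphs n)

-- `argmax` takes a starting element. With `R n`, the result is a tree as soon as `R n` is one,
-- without a separate proof that `trees n` is nonempty.
extremalTree : ∀ n → Graph n
extremalTree n = argmax av₁ (R n) (trees n)

extremalTree-isTree : ∀ n → IsTree (R n) → IsTree (extremalTree n)
extremalTree-isTree n R-tree = argmax-all av₁ {P = IsTree} R-tree (all-filter isTree? (graphs n))

extremalTree-maximal : ∀ n (T : Graph n) → IsTree T → av₁ T ℚ.≤ av₁ (extremalTree n)
extremalTree-maximal n T T-tree =
  let H , H∈ , T≐H = graphs-complete T
  in subst (ℚ._≤ av₁ (extremalTree n)) (sym (av₁-cong {G = T} {H} T≐H))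
       (argmax-maximal av₁ (R n) (∈-filter⁺ isTree? H∈ (IsTree-resp-≐ {G = T} {H} T≐H T-tree)))

-- The trees R n

inducedEdges-∑ : ∀ (G : Graph n) S → length (inducedEdges G S) ≡
  ∑[ i ∈ allFin n ] ∑[ j ∈ allFin n ]
    (⟦ does (i <? j) ∧ adj G i j ⟧ * ⟦ does (i ∈? S) ∧ does (j ∈? S) ⟧)
inducedEdges-∑ {n} G S =
  trans (length-filter≡∑ (λ (i , j) → (i ∈? S) ×-dec (j ∈? S)) (edges G))
  (trans (∑-filter (λ (i , j) → (i <? j) ×-dec T? (adj G i j)) (cartesianProduct (allFin n) (allFin n)) _)
         (∑-cartesianProduct (allFin n) (allFin n) _))

does-∈? : ∀ (i : Fin n) S → does (i ∈? S) ≡ lookup S i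
does-∈? zero    (inside  ∷ S) = refl
does-∈? zero    (outside ∷ S) = refl
does-∈? (suc i) (_       ∷ S) = does-∈? i S

-- Vertex zero is the smallest, so its edges all lie in the row `i = zero`, and the column
-- `j = zero` vanishes. What remains is the double sum for the graph without that vertex.
inducedEdges-∷ : ∀ (G : Graph (suc n)) b S → length (inducedEdges G (b ∷ S)) ≡
  ∑[ j ∈ allFin n ] (⟦ adj G zero (suc j) ⟧ * ⟦ b ∧ lookup S j ⟧) + length (inducedEdges (delete G) S)
inducedEdges-∷ {n} G b S = begin
  length (inducedEdges G (b ∷ S))
    ≡⟨ inducedEdges-∑ G (b ∷ S) ⟩
  ∑[ i ∈ allFin (suc n) ] ∑[ j ∈ allFin (suc n) ] w i j
    ≡⟨ ∑-allFin-suc n (λ i → ∑ (allFin (suc n)) (w i)) ⟩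
  ∑ (allFin (suc n)) (w zero) + ∑[ i ∈ allFin n ] ∑ (allFin (suc n)) (w (suc i))
    ≡⟨ cong₂ _+_ (trans (∑-allFin-suc n (w zero)) (∑-cong (allFin n) first))
                 (∑-cong (allFin n) (λ i → ∑-allFin-suc n (w (suc i)))) ⟩
  ∑[ j ∈ allFin n ] (⟦ adj G zero (suc j) ⟧ * ⟦ b ∧ lookup S j ⟧) +
    ∑[ i ∈ allFin n ] ∑[ j ∈ allFin n ] w (suc i) (suc j)
    ≡⟨ cong (∑[ j ∈ allFin n ] (⟦ adj G zero (suc j) ⟧ * ⟦ b ∧ lookup S j ⟧) +_)
            (inducedEdges-∑ (delete G) S) ⟨
  ∑[ j ∈ allFin n ] (⟦ adj G zero (suc j) ⟧ * ⟦ b ∧ lookup S j ⟧) + length (inducedEdges (delete G) S)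
    ∎
  where
  open ≡-Reasoning
  w : Fin (suc n) → Fin (suc n) → ℕ
  w i j = ⟦ does (i <? j) ∧ adj G i j ⟧ * ⟦ does (i ∈? (b ∷ S)) ∧ does (j ∈? (b ∷ S)) ⟧

  first : ∀ j → w zero (suc j) ≡ ⟦ adj G zero (suc j) ⟧ * ⟦ b ∧ lookup S j ⟧
  first j = cong (λ c → ⟦ adj G zero (suc j) ⟧ * ⟦ c ⟧) (cong₂ _∧_ (does-∈? zero (b ∷ S)) (does-∈? j S))

∑-∧ : ∀ b (S : Subset n) → ∑[ j ∈ allFin n ] ⟦ b ∧ lookup S j ⟧ ≡ (if b then ∣ S ∣ else 0)
∑-∧ {n} false S = ∑-zero (allFin n)
∑-∧     true  S = sym (∣∣≡∑ S)

inducedEdges-star : ∀ c (S : Subset n) →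
  length (inducedEdges (star (suc n)) (c ∷ S)) ≡ (if c then ∣ S ∣ else 0)
inducedEdges-star {n} c S = begin
  length (inducedEdges (star (suc n)) (c ∷ S))
    ≡⟨ inducedEdges-∷ (star (suc n)) c S ⟩
  ∑[ j ∈ allFin n ] (1 * ⟦ c ∧ lookup S j ⟧) + length (inducedEdges (delete (star (suc n))) S)
    ≡⟨ cong₂ _+_ (trans (∑-cong (allFin n) (λ j → ℕ.*-identityˡ _)) (∑-∧ c S)) no-edges ⟩
  (if c then ∣ S ∣ else 0) + 0
    ≡⟨ ℕ.+-identityʳ _ ⟩
  (if c then ∣ S ∣ else 0)
    ∎
  where
  open ≡-Reasoning
  no-edges : length (inducedEdges (delete (star (suc n))) S) ≡ 0
  no-edges = trans (inducedEdges-∑ (delete (star (suc n))) S)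
    (trans (∑-cong (allFin n) (λ i → trans (∑-cong (allFin n) (λ j →
              cong (λ b → ⟦ b ⟧ * ⟦ does (i ∈? S) ∧ does (j ∈? S) ⟧) (∧-zeroʳ (does (i <? j)))))
              (∑-zero (allFin n))))
           (∑-zero (allFin n)))

-- y is the attached vertex, c the centre of the star, x the leaf adjacent to y,
-- and L the set of the other leaves.
inducedEdges-R : ∀ k y c x (L : Subset k) → length (inducedEdges (R (3 + k)) (y ∷ c ∷ x ∷ L)) ≡
                 ⟦ y ∧ x ⟧ + (if c then ∣ x ∷ L ∣ else 0)
inducedEdges-R k y c x L =
  trans (inducedEdges-∷ (R (3 + k)) y (c ∷ x ∷ L))
        (cong₂ _+_ pendant (inducedEdges-star c (x ∷ L)))
  where
  open ≡-Reasoning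
  f : Fin (2 + k) → ℕ
  f j = ⟦ does (j ≟ suc zero) ⟧ * ⟦ y ∧ lookup (c ∷ x ∷ L) j ⟧

  pendant : ∑ (allFin (2 + k)) f ≡ ⟦ y ∧ x ⟧
  pendant = begin
    ∑ (allFin (2 + k)) f                          ≡⟨ ∑-allFin-suc (1 + k) f ⟩
    ∑[ j ∈ allFin (1 + k) ] f (suc j)             ≡⟨ ∑-allFin-suc k (λ j → f (suc j)) ⟩
    1 * ⟦ y ∧ x ⟧ + ∑[ j ∈ allFin k ] 0           ≡⟨ cong₂ _+_ (ℕ.*-identityˡ _) (∑-zero (allFin k)) ⟩
    ⟦ y ∧ x ⟧ + 0                                 ≡⟨ ℕ.+-identityʳ _ ⟩
    ⟦ y ∧ x ⟧                                     ∎

∑-subsets-one : ∀ k → ∑[ L ∈ subsets k ] 1 ≡ 2 ^ k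
∑-subsets-one zero    = refl
∑-subsets-one (suc k) = trans (∑-subsets-suc k (λ _ → 1))
  (cong₂ _+_ (∑-subsets-one k) (trans (∑-subsets-one k) (sym (ℕ.+-identityʳ _))))

-- Doubling avoids the exponent k - 1 of the usual closed form.
2*∑-subsets-∣∣ : ∀ k → 2 * ∑ (subsets k) ∣_∣ ≡ k * 2 ^ k
2*∑-subsets-∣∣ zero    = refl
2*∑-subsets-∣∣ (suc k) = begin
  2 * ∑ (subsets (suc k)) ∣_∣                      ≡⟨ cong (2 *_) (∑-subsets-suc k ∣_∣) ⟩
  2 * (s + ∑[ L ∈ subsets k ] (1 + ∣ L ∣))         ≡⟨ cong (λ t → 2 * (s + t)) (∑-+ (subsets k) (λ _ → 1) ∣_∣) ⟩
  2 * (s + (∑[ L ∈ subsets k ] 1 + s))             ≡⟨ cong (λ t → 2 * (s + (t + s))) (∑-subsets-one k) ⟩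
  2 * (s + (2 ^ k + s))                            ≡⟨ regroup s (2 ^ k) ⟩
  2 * s + 2 * s + 2 * 2 ^ k                        ≡⟨ cong (λ t → t + t + 2 * 2 ^ k) (2*∑-subsets-∣∣ k) ⟩
  k * 2 ^ k + k * 2 ^ k + 2 * 2 ^ k                ≡⟨ collect k (2 ^ k) ⟩
  suc k * (2 * 2 ^ k)                              ∎
  where
  open ≡-Reasoning
  s = ∑ (subsets k) ∣_∣
  regroup : ∀ s p → 2 * (s + (p + s)) ≡ 2 * s + 2 * s + 2 * p
  regroup = solve-∀
  collect : ∀ k p → k * p + k * p + 2 * p ≡ (1 + k) * (2 * p)
  collect = solve-∀

∑-subsets-empty : ∀ k → ∑[ L ∈ subsets k ] ⟦ does (∣ L ∣ ℕ.≟ 0) ⟧ ≡ 1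
∑-subsets-empty zero    = refl
∑-subsets-empty (suc k) = trans (∑-subsets-suc k (λ L → ⟦ does (∣ L ∣ ℕ.≟ 0) ⟧))
  (cong₂ _+_ (∑-subsets-empty k) (∑-zero (subsets k)))

∑-subsets-singleton : ∀ k → ∑[ L ∈ subsets k ] ⟦ does (∣ L ∣ ℕ.≟ 1) ⟧ ≡ k
∑-subsets-singleton zero    = refl
∑-subsets-singleton (suc k) = trans (∑-subsets-suc k (λ L → ⟦ does (∣ L ∣ ℕ.≟ 1) ⟧))
  (trans (cong₂ _+_ (∑-subsets-singleton k) (∑-subsets-empty k)) (ℕ.+-comm k 1))

∑-subsets-empty* : ∀ k (f : ℕ → ℕ) →
  ∑[ L ∈ subsets k ] (⟦ does (∣ L ∣ ℕ.≟ 0) ⟧ * f ∣ L ∣) ≡ f 0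
∑-subsets-empty* k f =
  trans (∑-cong (subsets k) (λ L → only ∣ L ∣))
  (trans (∑-*ʳ (subsets k) (f 0) _)
  (trans (cong (_* f 0) (∑-subsets-empty k)) (ℕ.*-identityˡ (f 0))))
  where
  only : ∀ m → ⟦ does (m ℕ.≟ 0) ⟧ * f m ≡ ⟦ does (m ℕ.≟ 0) ⟧ * f 0
  only zero    = refl
  only (suc m) = refl

∑-subsets-singleton* : ∀ k (f : ℕ → ℕ) →
  ∑[ L ∈ subsets k ] (⟦ does (∣ L ∣ ℕ.≟ 1) ⟧ * f ∣ L ∣) ≡ k * f 1
∑-subsets-singleton* k f =
  trans (∑-cong (subsets k) (λ L → only ∣ L ∣))
  (trans (∑-*ʳ (subsets k) (f 1) _) (cong (_* f 1) (∑-subsets-singleton k)))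
  where
  only : ∀ m → ⟦ does (m ℕ.≟ 1) ⟧ * f m ≡ ⟦ does (m ℕ.≟ 1) ⟧ * f 1
  only zero          = refl
  only (suc zero)    = refl
  only (suc (suc m)) = refl

-- The terms come, in this order, from the sets {c, leaf of L}, {c, x},
-- {y, x} ∪ L and {y, c, leaf of L}.
∑-R : ∀ k (f : ℕ → ℕ) → ∑[ S ∈ subsets (3 + k) ] (χ (R (3 + k)) S * f ∣ S ∣) ≡
      (k * f 2 + f 2) + (∑[ L ∈ subsets k ] f (2 + ∣ L ∣) + k * f 3)
∑-R k f = begin
  ∑[ S ∈ subsets (3 + k) ] (χ (R (3 + k)) S * f ∣ S ∣)
    ≡⟨ by-first-three (λ S → χ (R (3 + k)) S * f ∣ S ∣) ⟩
  ((sum-over false false false + sum-over false false true) +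
   (sum-over false true false + sum-over false true true)) +
  ((sum-over true false false + sum-over true false true) +
   (sum-over true true false + sum-over true true true))
    ≡⟨ cong₂ _+_
         (cong₂ _+_
           (cong₂ _+_ (trans (rewrite-χ false false false) none) (trans (rewrite-χ false false true) none))
           (cong₂ _+_ (trans (rewrite-χ false true false) (∑-subsets-singleton* k (f ∘ suc)))
                      (trans (rewrite-χ false true true) (∑-subsets-empty* k (λ m → f (2 + m))))))
         (cong₂ _+_
           (cong₂ _+_ (trans (rewrite-χ true false false) none)
                      (trans (rewrite-χ true false true) (∑-cong (subsets k) λ L → ℕ.*-identityˡ _)))
           (cong₂ _+_ (trans (rewrite-χ true true false) (∑-subsets-singleton* k (λ m → f (2 + m))))
                      (trans (rewrite-χ true true true) none))) ⟩
  (k * f 2 + f 2) + (∑[ L ∈ subsets k ] f (2 + ∣ L ∣) + (k * f 3 + 0))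
    ≡⟨ cong (λ t → (k * f 2 + f 2) + (∑[ L ∈ subsets k ] f (2 + ∣ L ∣) + t)) (ℕ.+-identityʳ _) ⟩
  (k * f 2 + f 2) + (∑[ L ∈ subsets k ] f (2 + ∣ L ∣) + k * f 3)
    ∎
  where
  open ≡-Reasoning

  sum-over : Bool → Bool → Bool → ℕ
  sum-over y c x = ∑[ L ∈ subsets k ] (χ (R (3 + k)) (y ∷ c ∷ x ∷ L) * f ∣ y ∷ c ∷ x ∷ L ∣)

  none : ∑[ L ∈ subsets k ] 0 ≡ 0
  none = ∑-zero (subsets k)

  rewrite-χ : ∀ y c x → sum-over y c x ≡ ∑[ L ∈ subsets k ]
    (⟦ does (⟦ y ∧ x ⟧ + (if c then ∣ x ∷ L ∣ else 0) ℕ.≟ 1) ⟧ * f ∣ y ∷ c ∷ x ∷ L ∣)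
  rewrite-χ y c x = ∑-cong (subsets k) λ L →
    cong (λ e → ⟦ does (e ℕ.≟ 1) ⟧ * f ∣ y ∷ c ∷ x ∷ L ∣) (inducedEdges-R k y c x L)

  by-first-three : ∀ (g : Subset (3 + k) → ℕ) → ∑ (subsets (3 + k)) g ≡
    ((∑[ L ∈ subsets k ] g (false ∷ false ∷ false ∷ L) + ∑[ L ∈ subsets k ] g (false ∷ false ∷ true ∷ L)) +
     (∑[ L ∈ subsets k ] g (false ∷ true ∷ false ∷ L) + ∑[ L ∈ subsets k ] g (false ∷ true ∷ true ∷ L))) +
    ((∑[ L ∈ subsets k ] g (true ∷ false ∷ false ∷ L) + ∑[ L ∈ subsets k ] g (true ∷ false ∷ true ∷ L)) +
     (∑[ L ∈ subsets k ] g (true ∷ true ∷ false ∷ L) + ∑[ L ∈ subsets k ] g (true ∷ true ∷ true ∷ L)))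
  by-first-three g = trans (∑-subsets-suc (2 + k) g) (cong₂ _+_
    (trans (∑-subsets-suc (1 + k) (λ S → g (false ∷ S)))
           (cong₂ _+_ (∑-subsets-suc k (λ S → g (false ∷ false ∷ S)))
                      (∑-subsets-suc k (λ S → g (false ∷ true ∷ S)))))
    (trans (∑-subsets-suc (1 + k) (λ S → g (true ∷ S)))
           (cong₂ _+_ (∑-subsets-suc k (λ S → g (true ∷ false ∷ S)))
                      (∑-subsets-suc k (λ S → g (true ∷ true ∷ S))))))

σ₁-R : ∀ k → σ₁ (R (3 + k)) ≡ 1 + 2 * k + 2 ^ k
σ₁-R k = begin
  σ₁ (R (3 + k))
    ≡⟨ σ₁≡∑χ (R (3 + k)) ⟩
  ∑ (subsets (3 + k)) (χ (R (3 + k)))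
    ≡⟨ ∑-cong (subsets (3 + k)) (λ S → ℕ.*-identityʳ _) ⟨
  ∑[ S ∈ subsets (3 + k) ] (χ (R (3 + k)) S * 1)
    ≡⟨ ∑-R k (λ _ → 1) ⟩
  (k * 1 + 1) + (∑[ L ∈ subsets k ] 1 + k * 1)
    ≡⟨ cong (λ p → (k * 1 + 1) + (p + k * 1)) (∑-subsets-one k) ⟩
  (k * 1 + 1) + (2 ^ k + k * 1)
    ≡⟨ collect k (2 ^ k) ⟩
  1 + 2 * k + 2 ^ k
    ∎
  where
  open ≡-Reasoning
  collect : ∀ k p → (k * 1 + 1) + (p + k * 1) ≡ 1 + 2 * k + p
  collect = solve-∀

2*S₁-R : ∀ k → 2 * S₁ (R (3 + k)) ≡ 4 + 10 * k + (4 + k) * 2 ^ k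
2*S₁-R k = begin
  2 * S₁ (R (3 + k))
    ≡⟨ cong (2 *_) (S₁≡∑χ (R (3 + k))) ⟩
  2 * ∑[ S ∈ subsets (3 + k) ] (χ (R (3 + k)) S * ∣ S ∣)
    ≡⟨ cong (2 *_) (∑-R k (λ m → m)) ⟩
  2 * ((k * 2 + 2) + (∑[ L ∈ subsets k ] (2 + ∣ L ∣) + k * 3))
    ≡⟨ cong (λ t → 2 * ((k * 2 + 2) + (t + k * 3)))
            (trans (∑-+ (subsets k) (λ _ → 2) ∣_∣) (cong (_+ s) (∑-*ˡ (subsets k) 2 (λ _ → 1)))) ⟩
  2 * ((k * 2 + 2) + (2 * ∑[ L ∈ subsets k ] 1 + s + k * 3))
    ≡⟨ cong (λ t → 2 * ((k * 2 + 2) + (2 * t + s + k * 3))) (∑-subsets-one k) ⟩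
  2 * ((k * 2 + 2) + (2 * 2 ^ k + s + k * 3))
    ≡⟨ isolate k (2 ^ k) s ⟩
  4 + 10 * k + 4 * 2 ^ k + 2 * s
    ≡⟨ cong (4 + 10 * k + 4 * 2 ^ k +_) (2*∑-subsets-∣∣ k) ⟩
  4 + 10 * k + 4 * 2 ^ k + k * 2 ^ k
    ≡⟨ collect k (2 ^ k) ⟩
  4 + 10 * k + (4 + k) * 2 ^ k
    ∎
  where
  open ≡-Reasoning
  s = ∑ (subsets k) ∣_∣
  isolate : ∀ k p s → 2 * ((k * 2 + 2) + (2 * p + s + k * 3)) ≡ 4 + 10 * k + 4 * p + 2 * s
  isolate = solve-∀
  collect : ∀ k p → 4 + 10 * k + 4 * p + k * p ≡ 4 + 10 * k + (4 + k) * p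
  collect = solve-∀

-- The graphs `R n` are trees

R-connected : ∀ k → Connected (R (3 + k))
R-connected k i j = to-centre i ◅◅ Star.reverse (λ {p} {q} → Adj-sym (R (3 + k)) {p} {q}) (to-centre j)
  where
  to-centre : ∀ i → Star (Adj (R (3 + k))) i (suc zero)
  -- After the shift by `attach` the centre is `suc zero`; the attached vertex reaches it through
  -- the leaf `suc (suc zero)`. All adjacency proofs compute to the unit type.
  to-centre zero                = _◅_ {j = suc (suc zero)} _ (_ ◅ ε)
  to-centre (suc zero)          = ε
  to-centre (suc (suc zero))    = _ ◅ ε
  to-centre (suc (suc (suc _))) = _ ◅ ε

Branching : Graph n → Fin n → Set
Branching G i = ∃[ p ] ∃[ q ] Adj G i p × Adj G i q × p ≢ q

last-linked : ∀ {_~_ : A → A → Set} {x z} xs → Linked _~_ (x ∷ xs ++ z ∷ []) → ∃[ y ] y ∈ x ∷ xs × y ~ z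
last-linked []       (x~z ∷ [-])   = _ , here refl , x~z
last-linked (y ∷ xs) (_ ∷ linked) = let w , w∈ , w~z = last-linked xs linked in w , there w∈ , w~z

-- Each vertex of a cycle has its two cyclic neighbours, and a cycle has at least three vertices.
-- `R n` is acyclic because at most its centre and the leaf carrying the attached vertex have two
-- neighbours.
cycle⇒three-branching : ∀ (G : Graph n) {v vs} → IsCycle G v vs →
  ∃[ a ] ∃[ b ] v ≢ a × v ≢ b × a ≢ b × Branching G v × Branching G a × Branching G b
cycle⇒three-branching G {v} {a ∷ b ∷ vs}
  (_ , (v≢a ∷ v≢b ∷ v≢vs) ∷ (a≢b ∷ a≢vs) ∷ _ , v~a ∷ a~b ∷ linked) =
  a , b , v≢a , v≢b , a≢b ,
  (let z , z∈ , z~v = last-linked vs linked in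
   a , z , v~a , Adj-sym G z~v , All.lookup (a≢b ∷ a≢vs) z∈) ,
  (v , b , Adj-sym G v~a , a~b , v≢b) ,
  (let z , b~z , a≢z = next vs linked a≢vs in a , z , Adj-sym G a~b , b~z , a≢z)
  where
  next : ∀ vs → Linked (Adj G) (b ∷ vs ++ v ∷ []) → All.All (a ≢_) vs → ∃[ z ] Adj G b z × a ≢ z
  next []      (b~v ∷ _) _         = v , b~v , v≢a ∘ sym
  next (z ∷ _) (b~z ∷ _) (a≢z ∷ _) = z , b~z , a≢z
cycle⇒three-branching G {v} {a ∷ []} (s≤s () , _)

R-branching : ∀ k i → Branching (R (3 + k)) i → i ≡ suc zero ⊎ i ≡ suc (suc zero)
R-branching k (zero) (suc (suc zero) , suc (suc zero) , _ , _ , p≢q) = contradiction refl p≢q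
R-branching k (suc zero) _ = inj₁ refl
R-branching k (suc (suc zero)) _ = inj₂ refl
R-branching k (suc (suc (suc i))) (suc zero , suc zero , _ , _ , p≢q) = contradiction refl p≢q

R-acyclic : ∀ k → Acyclic (R (3 + k))
R-acyclic k v vs cycle with cycle⇒three-branching (R (3 + k)) cycle
... | a , b , v≢a , v≢b , a≢b , v-br , a-br , b-br
  with R-branching k v v-br | R-branching k a a-br | R-branching k b b-br
... | inj₁ refl | inj₁ refl | _         = v≢a refl
... | inj₁ refl | inj₂ refl | inj₁ refl = v≢b refl
... | inj₁ refl | inj₂ refl | inj₂ refl = a≢b refl
... | inj₂ refl | inj₂ refl | _         = v≢a refl
... | inj₂ refl | inj₁ refl | inj₂ refl = v≢b refl
... | inj₂ refl | inj₁ refl | inj₁ refl = a≢b refl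

R-isTree : ∀ k → IsTree (R (3 + k))
R-isTree k = R-connected k , R-acyclic k

-- Estimates in ℚ

-- Opened only here: the constructor +_ makes sections such as (m +_) ambiguous.
open import Data.Integer using (+_)

-- Division in `ℚ` cancels a gcd, which does not compute on variables. Comparisons therefore pass to
-- unnormalised fractions, where they are cross multiplications.
toℚᵘ-/ : ∀ a b → ℚ.toℚᵘ (+ a ℚ./ suc b) ℚᵘ.≃ mkℚᵘ (+ a) b
toℚᵘ-/ a b = ℚ.toℚᵘ-fromℚᵘ (mkℚᵘ (+ a) b)

/-mono-< : ∀ a b c d → a * suc d < c * suc b → + a ℚ./ suc b ℚ.< + c ℚ./ suc d
/-mono-< a b c d ad<cb = ℚ.toℚᵘ-cancel-< (begin-strict
  ℚ.toℚᵘ (+ a ℚ./ suc b)  ≃⟨ toℚᵘ-/ a b ⟩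
  mkℚᵘ (+ a) b            <⟨ *<* (subst₂ ℤ._<_ (ℤ.pos-* a (suc d)) (ℤ.pos-* c (suc b)) (+<+ ad<cb)) ⟩
  mkℚᵘ (+ c) d            ≃⟨ toℚᵘ-/ c d ⟨
  ℚ.toℚᵘ (+ c ℚ./ suc d)  ∎)
  where open ℚᵘ.≤-Reasoning

/-cong-× : ∀ a b c d → a * suc d ≡ c * suc b → + a ℚ./ suc b ≡ + c ℚ./ suc d
/-cong-× a b c d ad≡cb = ℚ.fromℚᵘ-cong {mkℚᵘ (+ a) b} {mkℚᵘ (+ c) d}
  (*≡* (trans (sym (ℤ.pos-* a (suc d))) (trans (cong +_ ad≡cb) (ℤ.pos-* c (suc b)))))

/-+-/ : ∀ a b c d → + a ℚ./ suc b ℚ.+ + c ℚ./ suc d ≡ + (a * suc d + c * suc b) ℚ./ (suc b * suc d)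
/-+-/ a b c d = ℚ.toℚᵘ-injective (begin
  ℚ.toℚᵘ (+ a ℚ./ suc b ℚ.+ + c ℚ./ suc d)
    ≈⟨ ℚ.toℚᵘ-homo-+ (+ a ℚ./ suc b) (+ c ℚ./ suc d) ⟩
  ℚ.toℚᵘ (+ a ℚ./ suc b) ℚᵘ.+ ℚ.toℚᵘ (+ c ℚ./ suc d)
    ≈⟨ ℚᵘ.+-cong (toℚᵘ-/ a b) (toℚᵘ-/ c d) ⟩
  mkℚᵘ (+ a) b ℚᵘ.+ mkℚᵘ (+ c) d
    ≡⟨ cong (λ z → mkℚᵘ z (d + b * suc d)) numerator ⟩
  mkℚᵘ (+ (a * suc d + c * suc b)) (d + b * suc d)
    ≈⟨ toℚᵘ-/ (a * suc d + c * suc b) (d + b * suc d) ⟨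
  ℚ.toℚᵘ (+ (a * suc d + c * suc b) ℚ./ (suc b * suc d))
    ∎)
  where
  open ℚᵘ.≃-Reasoning
  numerator : + a ℤ.* + suc d ℤ.+ + c ℤ.* + suc b ≡ + (a * suc d + c * suc b)
  numerator = cong₂ ℤ._+_ (sym (ℤ.pos-* a (suc d))) (sym (ℤ.pos-* c (suc b)))

-- The strict hypothesis itself rules out `t = 0`, so the default value of `÷` never enters.
÷<half : ∀ s t p → 2 * s < p * t → s ÷ t ℚ.< + p ℚ./ 2
÷<half s zero    p 2s<0  = contradiction (subst (2 * s <_) (ℕ.*-zeroʳ p) 2s<0) ℕ.n≮0
÷<half s (suc t) p 2s<pt = /-mono-< s t p 1 (subst (_< p * suc t) (ℕ.*-comm 2 s) 2s<pt)

half<÷ : ∀ s t p → 0 < t → p * t < 2 * s → + p ℚ./ 2 ℚ.< s ÷ t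
half<÷ s (suc t) p _ pt<2s = /-mono-< p 1 s t (subst (p * suc t <_) (ℕ.*-comm 2 s) pt<2s)

half<÷+1/ : ∀ s t p b → 0 < t → p * (t * suc b) < (s * suc b + 1 * t) * 2 →
            + p ℚ./ 2 ℚ.< s ÷ t ℚ.+ + 1 ℚ./ suc b
half<÷+1/ s (suc t) p b _ lt =
  subst (+ p ℚ./ 2 ℚ.<_) (sym (/-+-/ s t 1 b))
    (/-mono-< p 1 (s * suc b + 1 * suc t) (b + t * suc b) lt)

half+½ : ∀ p → + p ℚ./ 2 ℚ.+ ½ ≡ + suc p ℚ./ 2
half+½ p = trans (/-+-/ p 1 1 1) (/-cong-× (p * 2 + 2) 3 (suc p) 1 (regroup p))
  where
  regroup : ∀ p → (p * 2 + 2) * 2 ≡ (1 + p) * 4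
  regroup = solve-∀

-- A positive rational has numerator at least 1, so the unit fraction over its own denominator lies
-- below it.
1/denominator≤ : ∀ η → 0ℚ ℚ.< η → ∃[ b ] + 1 ℚ./ suc b ℚ.≤ η
1/denominator≤ (mkℚ (+ zero) b _)  (ℚ.*<* (+<+ ()))
1/denominator≤ (mkℚ -[1+ _ ] b _)  (ℚ.*<* ())
1/denominator≤ (mkℚ +[1+ a ] b _) _ = b , ℚ.toℚᵘ-cancel-≤ (begin
  ℚ.toℚᵘ (+ 1 ℚ./ suc b)  ≃⟨ toℚᵘ-/ 1 b ⟩
  mkℚᵘ (+ 1) b            ≤⟨ *≤* (+≤+ (ℕ.*-monoˡ-≤ (suc b) (s≤s (z≤n {a})))) ⟩
  mkℚᵘ +[1+ a ] b         ∎)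
  where open ℚᵘ.≤-Reasoning

<+⇒-< : ∀ {x y z} → x ℚ.< y ℚ.+ z → x ℚ.- y ℚ.< z
<+⇒-< {x} {y} {z} x<y+z = subst (x ℚ.- y ℚ.<_) (xyx⁻¹≈y y z) (ℚ.+-monoˡ-< (ℚ.- y) x<y+z)

<⇒0<- : ∀ {x y} → x ℚ.< y → 0ℚ ℚ.< y ℚ.- x
<⇒0<- {x} {y} x<y = subst (ℚ._< y ℚ.- x) (ℚ.+-inverseʳ x) (ℚ.+-monoˡ-< (ℚ.- x) x<y)

close-from-below : ∀ {x l η} → x ℚ.< l → l ℚ.< x ℚ.+ η → ℚ.∣ (x ℚ.- l) ℚ.- 0ℚ ∣ ℚ.< η
close-from-below {x} {l} {η} x<l l<x+η = subst (ℚ._< η) (sym distance) (<+⇒-< l<x+η)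
  where
  open ≡-Reasoning
  distance : ℚ.∣ (x ℚ.- l) ℚ.- 0ℚ ∣ ≡ l ℚ.- x
  distance = begin
    ℚ.∣ (x ℚ.- l) ℚ.- 0ℚ ∣  ≡⟨ cong ℚ.∣_∣ (ℚ.+-identityʳ (x ℚ.- l)) ⟩
    ℚ.∣ x ℚ.- l ∣           ≡⟨ ℚ.∣-p∣≡∣p∣ (x ℚ.- l) ⟨
    ℚ.∣ ℚ.- (x ℚ.- l) ∣     ≡⟨ cong ℚ.∣_∣ (⁻¹-anti-homo‿- x l) ⟩
    ℚ.∣ l ℚ.- x ∣           ≡⟨ ℚ.0≤p⇒∣p∣≡p (ℚ.<⇒≤ (<⇒0<- x<l)) ⟩
    l ℚ.- x                 ∎

-- Polynomials against powers of two

exponential-bound : ∀ (f : ℕ → ℕ) a → f 0 ≤ 2 ^ a → (∀ j → f (suc j) ≤ 2 * f j) → ∀ j → f j ≤ 2 ^ (a + j)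
exponential-bound f a base step zero    = subst (λ m → f 0 ≤ 2 ^ m) (sym (ℕ.+-identityʳ a)) base
exponential-bound f a base step (suc j) = subst (λ m → f (suc j) ≤ 2 ^ m) (sym (ℕ.+-suc a j))
  (≤-trans (step j) (ℕ.*-monoʳ-≤ 2 (exponential-bound f a base step j)))

-- The left side is 2k² - 3k at k = 6 + j, that is, for n = 9 + j.
quadratic≤2^ : ∀ j → 54 + 21 * j + 2 * (j * j) ≤ 2 ^ (6 + j)
quadratic≤2^ = exponential-bound _ 6 (toWitness {a? = 54 ℕ.≤? 64} _) λ j →
  ≤-trans (ℕ.m≤m+n _ (31 + 17 * j + 2 * (j * j))) (≤-reflexive (difference j))
  where
  difference : ∀ j → 54 + 21 * (1 + j) + 2 * ((1 + j) * (1 + j)) + (31 + 17 * j + 2 * (j * j)) ≡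
                     2 * (54 + 21 * j + 2 * (j * j))
  difference = solve-∀

-- The induction starts at 10, where 1000 ≤ 1024; at 9 the bound fails, since 729 > 512.
cube≤2^ : ∀ j → (10 + j) * (10 + j) * (10 + j) ≤ 2 ^ (10 + j)
cube≤2^ = exponential-bound _ 10 (toWitness {a? = 1000 ℕ.≤? 1024} _) λ j →
  ≤-trans (ℕ.m≤m+n _ (669 + 237 * j + 27 * (j * j) + j * j * j)) (≤-reflexive (difference j))
  where
  difference : ∀ j → (11 + j) * (11 + j) * (11 + j) + (669 + 237 * j + 27 * (j * j) + j * j * j) ≡
                     2 * ((10 + j) * (10 + j) * (10 + j))
  difference = solve-∀

0<σ₁-R : ∀ k → 0 < σ₁ (R (3 + k))
0<σ₁-R k = subst (0 <_) (sym (σ₁-R k)) (s≤s z≤n)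

-- The right side exceeds the left by p + 1 - (54 + 21j + 2j²). Here `p` stands for `2 ^ (6 + j)`,
-- abstracted so that the ring solver meets only polynomials.
R-excess : ∀ j {p} → 54 + 21 * j + 2 * (j * j) ≤ p →
           (9 + j) * (1 + 2 * (6 + j) + p) < 4 + 10 * (6 + j) + (10 + j) * p
R-excess j {p} ≤p = begin-strict
  (9 + j) * (1 + 2 * (6 + j) + p)
    <⟨ ℕ.m<m+n _ {1} (s≤s z≤n) ⟩
  (9 + j) * (1 + 2 * (6 + j) + p) + 1
    ≡⟨ left j p ⟩
  54 + 21 * j + 2 * (j * j) + (64 + 10 * j + (9 + j) * p)
    ≤⟨ ℕ.+-monoˡ-≤ _ ≤p ⟩
  p + (64 + 10 * j + (9 + j) * p)
    ≡⟨ right j p ⟩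
  4 + 10 * (6 + j) + (10 + j) * p
    ∎
  where
  open ≤-Reasoning
  left : ∀ j p → (9 + j) * (1 + 2 * (6 + j) + p) + 1 ≡
                 54 + 21 * j + 2 * (j * j) + (64 + 10 * j + (9 + j) * p)
  left = solve-∀
  right : ∀ j p → p + (64 + 10 * j + (9 + j) * p) ≡ 4 + 10 * (6 + j) + (10 + j) * p
  right = solve-∀

half<av₁-R : ∀ n → 8 < n → + n ℚ./ 2 ℚ.< av₁ (R n)
half<av₁-R (suc (suc (suc k))) (s≤s (s≤s (s≤s 6≤k))) = half<÷ (S₁ (R (3 + k))) (σ₁ (R (3 + k))) (3 + k) (0<σ₁-R k)
  (subst₂ _<_ (cong ((3 + k) *_) (sym (σ₁-R k))) (sym (2*S₁-R k)) (excess k 6≤k))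
  where
  excess : ∀ k → 6 ≤ k → (3 + k) * (1 + 2 * k + 2 ^ k) < 4 + 10 * k + (4 + k) * 2 ^ k
  excess k 6≤k with ℕ.m≤n⇒∃[o]m+o≡n 6≤k
  ... | j , refl = R-excess j (quadratic≤2^ j)

-- (n + 1) σ₁ and 2 S₁ differ by 2 k² − k on R n with n = 3 + k, which is
-- negligible against σ₁ > 2 ^ k ≥ k³.
R-deficit : ∀ k q p s t → t ≡ 1 + 2 * k + p → 2 * s ≡ 4 + 10 * k + (4 + k) * p →
            q ≤ k → k * k * k ≤ p → (4 + k) * (t * q) < (s * q + 1 * t) * 2
R-deficit k q p s t t≡ 2s≡ q≤k k³≤p = begin-strict
  (4 + k) * (t * q)
    ≤⟨ ℕ.m≤m+n _ (k * q) ⟩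
  (4 + k) * (t * q) + k * q
    ≡⟨ factor (4 + k) t q k ⟩
  ((4 + k) * t + k) * q
    ≡⟨ cong (_* q) deficit ⟩
  (2 * s + 2 * (k * k)) * q
    ≡⟨ expand s (k * k) q ⟩
  s * q * 2 + 2 * (k * k * q)
    ≤⟨ ℕ.+-monoʳ-≤ (s * q * 2) (ℕ.*-monoʳ-≤ 2 (≤-trans (ℕ.*-monoʳ-≤ (k * k) q≤k) k³≤p)) ⟩
  s * q * 2 + 2 * p
    <⟨ ℕ.+-monoʳ-< (s * q * 2) (ℕ.*-monoʳ-< 2 p<t) ⟩
  s * q * 2 + 2 * t
    ≡⟨ merge (s * q) t ⟩
  (s * q + 1 * t) * 2
    ∎
  where
  open ≤-Reasoning
  p<t : p < t
  p<t = subst (p <_) (sym t≡) (s≤s (ℕ.m≤n+m p (2 * k)))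

  factor : ∀ c t q k → c * (t * q) + k * q ≡ (c * t + k) * q
  factor = solve-∀
  expand : ∀ s m q → (2 * s + 2 * m) * q ≡ s * q * 2 + 2 * (m * q)
  expand = solve-∀
  merge : ∀ u t → u * 2 + 2 * t ≡ (u + 1 * t) * 2
  merge = solve-∀
  identity : ∀ k p → (4 + k) * (1 + 2 * k + p) + k ≡ 4 + 10 * k + (4 + k) * p + 2 * (k * k)
  identity = solve-∀

  deficit : (4 + k) * t + k ≡ 2 * s + 2 * (k * k)
  deficit = trans (cong (λ u → (4 + k) * u + k) t≡)
    (trans (identity k p) (cong (_+ 2 * (k * k)) (sym 2s≡)))

-- In 13 + (b + 1), the 3 is the shift n = k + 3; what is left gives both k ≥ 10, for the cubic
-- bound, and k ≥ b + 1, for the comparison with the denominator.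
half<av₁-R+1/ : ∀ n b → 13 + suc b ≤ n → + suc n ℚ./ 2 ℚ.< av₁ (R n) ℚ.+ + 1 ℚ./ suc b
half<av₁-R+1/ (suc (suc (suc k))) b (s≤s (s≤s (s≤s 10+q≤k))) =
  half<÷+1/ (S₁ (R (3 + k))) (σ₁ (R (3 + k))) (4 + k) b (0<σ₁-R k)
    (R-deficit k (suc b) (2 ^ k) (S₁ (R (3 + k))) (σ₁ (R (3 + k))) (σ₁-R k) (2*S₁-R k)
    (ℕ.m+n≤o⇒n≤o 10 10+q≤k)
    (cube k (ℕ.m+n≤o⇒m≤o 10 10+q≤k)))
  where
  cube : ∀ k → 10 ≤ k → k * k * k ≤ 2 ^ k
  cube k 10≤k with ℕ.m≤n⇒∃[o]m+o≡n 10≤k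
  ... | j , refl = cube≤2^ j

-- The squeeze between `av₁ (R n)` and (n + 1) / 2

connected⇒av₁<[1+n]/2 : ∀ {n} → 3 < n → (G : Graph n) → Connected G → av₁ G ℚ.< + suc n ℚ./ 2
connected⇒av₁<[1+n]/2 {n} 3<n G connected = ÷<half (S₁ G) (σ₁ G) (suc n) (2*S₁<[1+n]*σ₁ G connected 3<n)

squeezed⇒TendsTo : ∀ (a : ℕ → ℚ) → (∀ n → 8 < n → av₁ (R n) ℚ.≤ a n × a n ℚ.< + suc n ℚ./ 2) →
           TendsTo (λ n → a n ℚ.- + suc n ℚ./ 2) 0ℚ
squeezed⇒TendsTo a squeeze η 0<η with 1/denominator≤ η 0<η
... | b , 1/b≤η = 13 + suc b , λ n N≤n →
  let R≤a , a<l = squeeze n (≤-trans (ℕ.m≤m+n 9 (4 + suc b)) N≤n)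
  in close-from-below a<l (ℚ.<-≤-trans (half<av₁-R+1/ n b N≤n) (ℚ.+-mono-≤ R≤a 1/b≤η))

mainTheorem13 : Σ[ M ∈ (ℕ → ℚ) ]
    ( (∀ n → 8 < n →
    IsMaxAv₁ n (M n)
    × (∃[ δ ] M n ≡ + n ℚ./ 2 ℚ.+ δ × 0ℚ ℚ.< δ × δ ℚ.< ½))
    × TendsTo (λ n → M n ℚ.- + suc n ℚ./ 2) 0ℚ
    × (∀ n → 8 < n →
    IsTree (R n)
    × + n ℚ./ 2 ℚ.< av₁ (R n)
    × av₁ (R n) ℚ.< + suc n ℚ./ 2)
    × TendsTo (λ n → av₁ (R n) ℚ.- + suc n ℚ./ 2) 0ℚ )
mainTheorem13 =
  M ,
  (λ n 8<n → maximal n 8<n , M n ℚ.- + n ℚ./ 2 , sym (add-back (+ n ℚ./ 2) (M n)) ,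
    <⇒0<- (ℚ.<-≤-trans (half<av₁-R n 8<n) (R≤M n 8<n)) ,
    <+⇒-< (subst (M n ℚ.<_) (sym (half+½ n)) (M-below n 8<n))) ,
  squeezed⇒TendsTo M (λ n 8<n → R≤M n 8<n , M-below n 8<n) ,
  (λ n 8<n → R-tree n 8<n , half<av₁-R n 8<n , R-below n 8<n) ,
  squeezed⇒TendsTo (λ n → av₁ (R n)) (λ n 8<n → ℚ.≤-refl , R-below n 8<n)
  where
  -- Values at n ≤ 8 are merely whatever the argmax returns; limits ignore them.
  M : ℕ → ℚ
  M n = av₁ (extremalTree n)

  add-back : ∀ x y → x ℚ.+ (y ℚ.- x) ≡ y
  add-back x y = trans (sym (ℚ.+-assoc x y (ℚ.- x))) (xyx⁻¹≈y x y)

  3<n : ∀ {n} → 8 < n → 3 < n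
  3<n = ≤-trans (s≤s (s≤s (s≤s (s≤s z≤n))))

  R-tree : ∀ n → 8 < n → IsTree (R n)
  R-tree (suc (suc (suc k))) _ = R-isTree k
  R-tree (suc zero)       (s≤s ())
  R-tree (suc (suc zero)) (s≤s (s≤s ()))

  R-below : ∀ n → 8 < n → av₁ (R n) ℚ.< + suc n ℚ./ 2
  R-below n 8<n = connected⇒av₁<[1+n]/2 (3<n 8<n) (R n) (proj₁ (R-tree n 8<n))

  M-tree : ∀ n → 8 < n → IsTree (extremalTree n)
  M-tree n 8<n = extremalTree-isTree n (R-tree n 8<n)

  M-below : ∀ n → 8 < n → M n ℚ.< + suc n ℚ./ 2
  M-below n 8<n = connected⇒av₁<[1+n]/2 (3<n 8<n) (extremalTree n) (proj₁ (M-tree n 8<n))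

  R≤M : ∀ n → 8 < n → av₁ (R n) ℚ.≤ M n
  R≤M n 8<n = extremalTree-maximal n (R n) (R-tree n 8<n)

  maximal : ∀ n → 8 < n → IsMaxAv₁ n (M n)
  maximal n 8<n = (extremalTree n , M-tree n 8<n , refl) , extremalTree-maximal n
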